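{- Let $R$ be one of the reduction rules of $\mathbf{IPC}$, let $\to_R$ be its compatible closure, and let $(\cdot)^{\lozenge}$ be the optimized translation from proof terms of $\mathbf{IPC}$ to proof terms of $\mathbf{F}_{\mathbf{at}}$. For all proof terms $M,N$ of $\mathbf{IPC}$: 1. Case $R\in\{\beta_{\supset},\beta_{\wedge}\}$: if $M\to_R N$ in $\mathbf{IPC}$, then $M^{\lozenge}\to_{\beta}^* N^{\lozenge}$ in $\mathbf{F}_{\mathbf{at}}$. 2. Case $R\in\{\beta_{\vee},\eta_{\vee},\eta_{\supset},\eta_{\wedge}\}$: if $M\to_R N$ in $\mathbf{IPC}$, then $M^{\lozenge}\to_{\beta\eta}^* N^{\lozenge}$ in $\mathbf{F}_{\mathbf{at}}$. 3. Case $R\in\{\pi_{\supset},\pi_{\wedge},\pi_{\vee},\pi_{\perp},\varpi_{\supset},\varpi_{\wedge},\varpi_{\vee},\varpi_{\perp}\}$: if $M\to_R N$ in $\mathbf{IPC}$, then $M^{\lozenge}=N^{\lozenge}$ in $\mathbf{F}_{\mathbf{at}}$ (syntactic identity modulo $\alpha$-equivalence).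
   Context: Everything is modulo $\alpha$-equivalence; bound variables are renamed when necessary, and substitution $[N/x]M$, $[Y/X]M$ is capture-avoiding. $x\notin M$, $X\notin M$, $X\notin A$ mean "not free in". Type annotations in proof terms are often omitted. For a rule (or set of rules) $R$, $\to_R$ is its compatible closure, $\to_R^*$ the reflexive-transitive closure of $\to_R$; $\beta\eta$ means $\beta\cup\eta$. **System $\mathbf{IPC}$.** Types: $A::=X\mid\perp\mid A\supset B\mid A\wedge B\mid A\vee B$ ($X$ type variables). Proof terms: $x\mid\lambda x^A.M\mid MN\mid\langle M,N\rangle\mid M1\mid M2\mid \mathsf{in}_1(M,A,B)\mid\mathsf{in}_2(N,A,B)\mid\mathsf{case}(M,x^A.P,y^B.Q,C)\mid\mathsf{abort}(M,A)$ ($M1,M2$ are the projections; in $\mathsf{case}$, $x$ is bound in $P$ and $y$ in $Q$). Reduction rules of $\mathbf{IPC}$ ($i\in\{1,2\}$): - $(\beta_\supset)$ $(\lambda x.M)N\to[N/x]M$; $(\beta_\wedge)$ $\langle M_1,M_2\rangle i\to M_i$; $(\beta_\vee)$ $\mathsf{case}(\mathsf{in}_i(M,A_1,A_2),x_1^{A_1}.P_1,x_2^{A_2}.P_2,C)\to[M/x_i]P_i$. - $(\pi_\supset)$ $\mathsf{case}(M,x.P,y.Q,C\supset D)N\to\mathsf{case}(M,x.PN,y.QN,D)$. - $(\pi_\wedge)$ $\mathsf{case}(M,x.P,y.Q,C_1\wedge C_2)i\to\mathsf{case}(M,x.Pi,y.Qi,C_i)$. - $(\pi_\vee)$ $\mathsf{case}(\mathsf{case}(M,x'.P',y'.Q',C\vee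 D),x^C.P,y^D.Q,E)\to\mathsf{case}(M,x'.\mathsf{case}(P',x^C.P,y^D.Q,E),y'.\mathsf{case}(Q',x^C.P,y^D.Q,E),E)$. - $(\pi_\perp)$ $\mathsf{abort}(\mathsf{case}(M,x.P,y.Q,\perp),C)\to\mathsf{case}(M,x.\mathsf{abort}(P,C),y.\mathsf{abort}(Q,C),C)$. - $(\varpi_\supset)$ $\mathsf{abort}(M,C\supset D)N\to\mathsf{abort}(M,D)$; $(\varpi_\wedge)$ $\mathsf{abort}(M,C_1\wedge C_2)i\to\mathsf{abort}(M,C_i)$; $(\varpi_\vee)$ $\mathsf{case}(\mathsf{abort}(M,C\vee D),x^C.P,y^D.Q,E)\to\mathsf{abort}(M,E)$; $(\varpi_\perp)$ $\mathsf{abort}(\mathsf{abort}(M,\perp),C)\to\mathsf{abort}(M,C)$. - $(\eta_\supset)$ $\lambda x.Mx\to M$ ($x\notin M$); $(\eta_\wedge)$ $\langle M1,M2\rangle\to M$; $(\eta_\vee)$ $\mathsf{case}(M,x^A.\mathsf{in}_1(x,A,B),y^B.\mathsf{in}_2(y,A,B),A\vee B)\to M$. **System $\mathbf{F}_{\mathbf{at}}$** (atomic polymorphic $\lambda$-calculus). Types: $A::=X\mid A\supset B\mid A\wedge B\mid\forall X.A$. Proof terms: $x\mid\lambda x^A.M\mid MN\mid\langle M,N\rangle\mid M1\mid M2\mid\Lambda X.M\mid MX$ ($X$ a type variable). Reduction rules: $\beta=\beta_\supset\cup\beta_\wedge\cup\beta_\forall$ and $\eta=\eta_\supset\cup\eta_\wedge\cup\eta_\forall$,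 with $\beta_\supset,\beta_\wedge,\eta_\supset,\eta_\wedge$ as in $\mathbf{IPC}$, $(\beta_\forall)$ $(\Lambda X.M)Y\to[Y/X]M$, $(\eta_\forall)$ $\Lambda X.MX\to M$ ($X\notin M$). **Derived constructions in $\mathbf{F}_{\mathbf{at}}$.** - $A\,\underline\vee\,B:=\forall X.((A\supset X)\wedge(B\supset X))\supset X$ with $X\notin A,B$; $\underline\perp:=\forall X.X$. - $\underline{\lambda}x^A.M:=\lambda w^A.(\lambda x^A.M)w$ with $w\notin M$; $\langle\!\langle M,N\rangle\!\rangle:=\langle\langle M,N\rangle1,\langle M,N\rangle2\rangle$. - $M@i:=N_i$ if $M=\langle N_1,N_2\rangle$, and $M@i:=Mi$ otherwise ($i\in\{1,2\}$); $M@N:=[N/x]P$ if $M=\lambda x.P$, and $MN$ otherwise; $M@Y:=[Y/X]P$ if $M=\Lambda X.P$, and $MY$ otherwise. - $\mathrm{IN}_i(M,A,B):=\Lambda X.\lambda w^{(A\supset X)\wedge(B\supset X)}.(w\,i)M$ with $X\notin M,A,B$ and $w\notin M$. - $\mathrm{CASE}(M,x^A.P,y^B.Q,C)$ by recursion on $C$: for $C=X$ it is $(M@X)@\langle\lambda x.P,\lambda y.Q\rangle$; for $C=C_1\wedge C_2$ it is the pair with components $\mathrm{CASE}(M,x.P@i,y.Q@i,C_i)$, $i=1,2$; for $C=C_1\supset C_2$ it is $\lambda z.\mathrm{CASE}(M,x.P@z,y.Q@z,C_2)$ (with $z$ of type $C_1$), where $z\ne x,y$, $z\notin M,P,Q$;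 for $C=\forall X.C_0$ it is $\Lambda X.\mathrm{CASE}(M,x.P@X,y.Q@X,C_0)$ with $X\notin M,P,Q,A,B$. - $\mathrm{ABORT}(M,A)$ by recursion on $A$: $\mathrm{ABORT}(M,X)=M@X$; $\mathrm{ABORT}(M,A_1\wedge A_2)=\langle\mathrm{ABORT}(M,A_1),\mathrm{ABORT}(M,A_2)\rangle$; $\mathrm{ABORT}(M,B\supset C)=\lambda z^B.\mathrm{ABORT}(M,C)$ with $z\notin M$; $\mathrm{ABORT}(M,\forall X.A)=\Lambda X.\mathrm{ABORT}(M,A)$ with $X\notin M$. **Optimized translation $(\cdot)^\lozenge$.** On types: $X^\lozenge=X$, $\perp^\lozenge=\underline\perp$, $(A\supset B)^\lozenge=A^\lozenge\supset B^\lozenge$, $(A\wedge B)^\lozenge=A^\lozenge\wedge B^\lozenge$, $(A\vee B)^\lozenge=A^\lozenge\,\underline\vee\,B^\lozenge$. On terms: $x^\lozenge=x$; $(\lambda x^A.M)^\lozenge=\underline\lambda x^{A^\lozenge}.M^\lozenge$; $\langle M,N\rangle^\lozenge=\langle\!\langle M^\lozenge,N^\lozenge\rangle\!\rangle$; $(\mathsf{in}_i(M,A,B))^\lozenge=\mathrm{IN}_i(M^\lozenge,A^\lozenge,B^\lozenge)$; $(MN)^\lozenge=M^\lozenge@N^\lozenge$; $(Mi)^\lozenge=M^\lozenge@i$; $\mathsf{case}(M,x^A.P,y^B.Q,C)^\lozenge=\mathrm{CASE}(M^\lozenge,x^{A^\lozenge}.P^\lozenge,y^{B^\lozenge}.Q^\lozenge,C^\lozenge)$;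 $\mathsf{abort}(M,A)^\lozenge=\mathrm{ABORT}(M^\lozenge,A^\lozenge)$.
   Formalization: In case 2, M is assumed to be typable in IPC in some context: for raw terms the claim fails, e.g. λx^A.(λu^D.y)x → λu^D.y by η⊃ with A ≠ D; cases 1 and 3 are for all raw terms. -}

module Defs where

open import Data.Fin using (Fin; zero; suc; lift)
open import Data.Nat using (ℕ; suc)
open import Data.Vec using (Vec; lookup) renaming (_∷_ to _▸_)
open import Data.Vec.Functional using (_∷_)
open import Function using (id)
open import Level using (0ℓ)
open import Relation.Binary using (Rel)
open import Relation.Binary.Construct.Closure.ReflexiveTransitive using (Star)
open import Relation.Binary.Construct.Union using (_∪_)
open import Relation.Binary.PropositionalEquality using (_≡_)

-- Both calculi are given by well-scoped de Bruijn terms, so that α-equivalent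
-- terms are identical.  Throughout, n counts the type variables in scope and
-- m the term variables; a side condition "x ∉ M" becomes a weakening of M.

-- The index i ∈ {1,2} of projections and injections.
data Side : Set where
  one two : Side

pick : ∀ {a} {A : Set a} → Side → A → A → A
pick one a b = a
pick two a b = b

module IPC where

  infixr 7 _⊃_
  infixr 8 _∨_
  infixr 9 _∧_
  infixl 9 _·_

  data Form (n : ℕ) : Set where
    `_          : Fin n → Form n
    ⊥           : Form n
    _⊃_ _∧_ _∨_ : Form n → Form n → Form n

  -- case M A P B Q C is case(M, x^A.P, y^B.Q, C).
  data Term (n : ℕ) : ℕ → Set where
    var   : ∀ {m} → Fin m → Term n m
    ƛ     : ∀ {m} → Form n → Term n (suc m) → Term n m
    _·_   : ∀ {m} → Term n m → Term n m → Term n m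
    ⟨_,_⟩ : ∀ {m} → Term n m → Term n m → Term n m
    proj  : ∀ {m} → Side → Term n m → Term n m
    inj   : ∀ {m} → Side → Term n m → Form n → Form n → Term n m
    case  : ∀ {m} → Term n m → Form n → Term n (suc m) →
            Form n → Term n (suc m) → Form n → Term n m
    abort : ∀ {m} → Term n m → Form n → Term n m

  module _ {n : ℕ} where

    ren : ∀ {m k} → (Fin m → Fin k) → Term n m → Term n k
    ren ρ (var x)            = var (ρ x)
    ren ρ (ƛ A M)            = ƛ A (ren (lift 1 ρ) M)
    ren ρ (M · N)            = ren ρ M · ren ρ N
    ren ρ ⟨ M , N ⟩          = ⟨ ren ρ M , ren ρ N ⟩
    ren ρ (proj i M)         = proj i (ren ρ M)
    ren ρ (inj i M A B)      = inj i (ren ρ M) A B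
    ren ρ (case M A P B Q C) =
      case (ren ρ M) A (ren (lift 1 ρ) P) B (ren (lift 1 ρ) Q) C
    ren ρ (abort M A)        = abort (ren ρ M) A

    wk : ∀ {m} → Term n m → Term n (suc m)
    wk = ren suc

    -- Weakening by a variable inserted just below the innermost one.
    wk₁ : ∀ {m} → Term n (suc m) → Term n (suc (suc m))
    wk₁ = ren (lift 1 suc)

    exts : ∀ {m k} → (Fin m → Term n k) → Fin (suc m) → Term n (suc k)
    exts σ zero    = var zero
    exts σ (suc x) = wk (σ x)

    sub : ∀ {m k} → (Fin m → Term n k) → Term n m → Term n k
    sub σ (var x)            = σ x
    sub σ (ƛ A M)            = ƛ A (sub (exts σ) M)
    sub σ (M · N)            = sub σ M · sub σ N
    sub σ ⟨ M , N ⟩          = ⟨ sub σ M , sub σ N ⟩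
    sub σ (proj i M)         = proj i (sub σ M)
    sub σ (inj i M A B)      = inj i (sub σ M) A B
    sub σ (case M A P B Q C) =
      case (sub σ M) A (sub (exts σ) P) B (sub (exts σ) Q) C
    sub σ (abort M A)        = abort (sub σ M) A

    infix 10 _[_]

    _[_] : ∀ {m} → Term n (suc m) → Term n m → Term n m
    M [ N ] = sub (N ∷ var) M

    infix 4 _⊢_∶_

    data _⊢_∶_ {m} (Γ : Vec (Form n) m) : Term n m → Form n → Set where
      var   : ∀ {x A} → lookup Γ x ≡ A → Γ ⊢ var x ∶ A
      ƛ     : ∀ {A B M} → A ▸ Γ ⊢ M ∶ B → Γ ⊢ ƛ A M ∶ A ⊃ B
      _·_   : ∀ {A B M N} → Γ ⊢ M ∶ A ⊃ B → Γ ⊢ N ∶ A → Γ ⊢ M · N ∶ B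
      ⟨_,_⟩ : ∀ {A B M N} → Γ ⊢ M ∶ A → Γ ⊢ N ∶ B → Γ ⊢ ⟨ M , N ⟩ ∶ A ∧ B
      proj  : ∀ {A B M} i → Γ ⊢ M ∶ A ∧ B → Γ ⊢ proj i M ∶ pick i A B
      inj   : ∀ {A B M} i → Γ ⊢ M ∶ pick i A B → Γ ⊢ inj i M A B ∶ A ∨ B
      case  : ∀ {A B C M P Q} → Γ ⊢ M ∶ A ∨ B → A ▸ Γ ⊢ P ∶ C → B ▸ Γ ⊢ Q ∶ C →
              Γ ⊢ case M A P B Q C ∶ C
      abort : ∀ {A M} → Γ ⊢ M ∶ ⊥ → Γ ⊢ abort M A ∶ A

  data Rule : Set where
    β⊃ β∧ β∨ π⊃ π∧ π∨ π⊥ ϖ⊃ ϖ∧ ϖ∨ ϖ⊥ η⊃ η∧ η∨ : Rule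

  infix 4 _▷[_]_ _⟶[_]_

  data _▷[_]_ {n m} : Term n m → Rule → Term n m → Set where
    β⊃ : ∀ {A M N} → ƛ A M · N ▷[ β⊃ ] M [ N ]
    β∧ : ∀ {M₁ M₂} i → proj i ⟨ M₁ , M₂ ⟩ ▷[ β∧ ] pick i M₁ M₂
    β∨ : ∀ {M A₁ A₂ P₁ P₂ C} i →
         case (inj i M A₁ A₂) A₁ P₁ A₂ P₂ C ▷[ β∨ ] pick i P₁ P₂ [ M ]

    π⊃ : ∀ {M A P B Q C D N} →
         case M A P B Q (C ⊃ D) · N ▷[ π⊃ ]
         case M A (P · wk N) B (Q · wk N) D
    π∧ : ∀ {M A P B Q C₁ C₂} i →
         proj i (case M A P B Q (C₁ ∧ C₂)) ▷[ π∧ ]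
         case M A (proj i P) B (proj i Q) (pick i C₁ C₂)
    π∨ : ∀ {M A P′ B Q′ C P D Q E} →
         case (case M A P′ B Q′ (C ∨ D)) C P D Q E ▷[ π∨ ]
         case M A (case P′ C (wk₁ P) D (wk₁ Q) E)
                B (case Q′ C (wk₁ P) D (wk₁ Q) E) E
    π⊥ : ∀ {M A P B Q C} →
         abort (case M A P B Q ⊥) C ▷[ π⊥ ]
         case M A (abort P C) B (abort Q C) C

    ϖ⊃ : ∀ {M C D N} → abort M (C ⊃ D) · N ▷[ ϖ⊃ ] abort M D
    ϖ∧ : ∀ {M C₁ C₂} i →
         proj i (abort M (C₁ ∧ C₂)) ▷[ ϖ∧ ] abort M (pick i C₁ C₂)
    ϖ∨ : ∀ {M C P D Q E} →
         case (abort M (C ∨ D)) C P D Q E ▷[ ϖ∨ ] abort M E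
    ϖ⊥ : ∀ {M C} → abort (abort M ⊥) C ▷[ ϖ⊥ ] abort M C

    η⊃ : ∀ {A M} → ƛ A (wk M · var zero) ▷[ η⊃ ] M
    η∧ : ∀ {M} → ⟨ proj one M , proj two M ⟩ ▷[ η∧ ] M
    η∨ : ∀ {M A B} →
         case M A (inj one (var zero) A B) B (inj two (var zero) A B) (A ∨ B)
         ▷[ η∨ ] M

  data _⟶[_]_ {n m} : Term n m → Rule → Term n m → Set where
    root  : ∀ {R M N} → M ▷[ R ] N → M ⟶[ R ] N
    ƛ     : ∀ {R A M M′} → M ⟶[ R ] M′ → ƛ A M ⟶[ R ] ƛ A M′
    ·ˡ    : ∀ {R M M′ N} → M ⟶[ R ] M′ → M · N ⟶[ R ] M′ · N
    ·ʳ    : ∀ {R M N N′} → N ⟶[ R ] N′ → M · N ⟶[ R ] M · N′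
    ⟨⟩ˡ   : ∀ {R M M′ N} → M ⟶[ R ] M′ → ⟨ M , N ⟩ ⟶[ R ] ⟨ M′ , N ⟩
    ⟨⟩ʳ   : ∀ {R M N N′} → N ⟶[ R ] N′ → ⟨ M , N ⟩ ⟶[ R ] ⟨ M , N′ ⟩
    proj  : ∀ {R i M M′} → M ⟶[ R ] M′ → proj i M ⟶[ R ] proj i M′
    inj   : ∀ {R i M M′ A B} → M ⟶[ R ] M′ → inj i M A B ⟶[ R ] inj i M′ A B
    case₁ : ∀ {R M M′ A P B Q C} → M ⟶[ R ] M′ →
            case M A P B Q C ⟶[ R ] case M′ A P B Q C
    case₂ : ∀ {R M A P P′ B Q C} → P ⟶[ R ] P′ →
            case M A P B Q C ⟶[ R ] case M A P′ B Q C
    case₃ : ∀ {R M A P B Q Q′ C} → Q ⟶[ R ] Q′ →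
            case M A P B Q C ⟶[ R ] case M A P B Q′ C
    abort : ∀ {R M M′ A} → M ⟶[ R ] M′ → abort M A ⟶[ R ] abort M′ A

module Fat where

  infixr 7 _⊃_
  infixr 8 _∨_
  infixr 9 _∧_
  infixl 9 _·_ _∙_ _＠_ _＠ᵗ_

  data Type (n : ℕ) : Set where
    `_      : Fin n → Type n
    _⊃_ _∧_ : Type n → Type n → Type n
    ∀′      : Type (suc n) → Type n

  -- Universal instantiation M ∙ X is atomic, so only renamings ever act on
  -- type variables.
  data Term : ℕ → ℕ → Set where
    var   : ∀ {n m} → Fin m → Term n m
    ƛ     : ∀ {n m} → Type n → Term n (suc m) → Term n m
    _·_   : ∀ {n m} → Term n m → Term n m → Term n m
    ⟨_,_⟩ : ∀ {n m} → Term n m → Term n m → Term n m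
    proj  : ∀ {n m} → Side → Term n m → Term n m
    Λ     : ∀ {n m} → Term (suc n) m → Term n m
    _∙_   : ∀ {n m} → Term n m → Fin n → Term n m

  renType : ∀ {n k} → (Fin n → Fin k) → Type n → Type k
  renType ρ (` X)   = ` ρ X
  renType ρ (A ⊃ B) = renType ρ A ⊃ renType ρ B
  renType ρ (A ∧ B) = renType ρ A ∧ renType ρ B
  renType ρ (∀′ A)  = ∀′ (renType (lift 1 ρ) A)

  wkType : ∀ {n} → Type n → Type (suc n)
  wkType = renType suc

  -- Renaming of type variables in terms (superscript t), and of term variables.

  renᵗ : ∀ {n k m} → (Fin n → Fin k) → Term n m → Term k m
  renᵗ ρ (var x)    = var x
  renᵗ ρ (ƛ A M)    = ƛ (renType ρ A) (renᵗ ρ M)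
  renᵗ ρ (M · N)    = renᵗ ρ M · renᵗ ρ N
  renᵗ ρ ⟨ M , N ⟩  = ⟨ renᵗ ρ M , renᵗ ρ N ⟩
  renᵗ ρ (proj i M) = proj i (renᵗ ρ M)
  renᵗ ρ (Λ M)      = Λ (renᵗ (lift 1 ρ) M)
  renᵗ ρ (M ∙ X)    = renᵗ ρ M ∙ ρ X

  ren : ∀ {n m k} → (Fin m → Fin k) → Term n m → Term n k
  ren ρ (var x)    = var (ρ x)
  ren ρ (ƛ A M)    = ƛ A (ren (lift 1 ρ) M)
  ren ρ (M · N)    = ren ρ M · ren ρ N
  ren ρ ⟨ M , N ⟩  = ⟨ ren ρ M , ren ρ N ⟩
  ren ρ (proj i M) = proj i (ren ρ M)
  ren ρ (Λ M)      = Λ (ren ρ M)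
  ren ρ (M ∙ X)    = ren ρ M ∙ X

  wkᵗ : ∀ {n m} → Term n m → Term (suc n) m
  wkᵗ = renᵗ suc

  wk : ∀ {n m} → Term n m → Term n (suc m)
  wk = ren suc

  -- Weakening by a term variable inserted just below the innermost one.
  wk₁ : ∀ {n m} → Term n (suc m) → Term n (suc (suc m))
  wk₁ = ren (lift 1 suc)

  exts : ∀ {n m k} → (Fin m → Term n k) → Fin (suc m) → Term n (suc k)
  exts σ zero    = var zero
  exts σ (suc x) = wk (σ x)

  sub : ∀ {n m k} → (Fin m → Term n k) → Term n m → Term n k
  sub σ (var x)    = σ x
  sub σ (ƛ A M)    = ƛ A (sub (exts σ) M)
  sub σ (M · N)    = sub σ M · sub σ N
  sub σ ⟨ M , N ⟩  = ⟨ sub σ M , sub σ N ⟩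
  sub σ (proj i M) = proj i (sub σ M)
  sub σ (Λ M)      = Λ (sub (λ x → wkᵗ (σ x)) M)
  sub σ (M ∙ X)    = sub σ M ∙ X

  infix 10 _[_] _[_]ᵗ

  _[_] : ∀ {n m} → Term n (suc m) → Term n m → Term n m
  M [ N ] = sub (N ∷ var) M

  _[_]ᵗ : ∀ {n m} → Term (suc n) m → Fin n → Term n m
  M [ Y ]ᵗ = renᵗ (Y ∷ id) M

  data β {n m} : Rel (Term n m) 0ℓ where
    β⊃ : ∀ {A M N} → β (ƛ A M · N) (M [ N ])
    β∧ : ∀ {M₁ M₂} i → β (proj i ⟨ M₁ , M₂ ⟩) (pick i M₁ M₂)
    β∀ : ∀ {M Y} → β (Λ M ∙ Y) (M [ Y ]ᵗ)

  data η {n m} : Rel (Term n m) 0ℓ where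
    η⊃ : ∀ {A M} → η (ƛ A (wk M · var zero)) M
    η∧ : ∀ {M} → η ⟨ proj one M , proj two M ⟩ M
    η∀ : ∀ {M} → η (Λ (wkᵗ M ∙ zero)) M

  βη : ∀ {n m} → Rel (Term n m) 0ℓ
  βη = β ∪ η

  data Compatible (R : ∀ {n m} → Rel (Term n m) 0ℓ) {n m} : Rel (Term n m) 0ℓ where
    root : ∀ {M N} → R M N → Compatible R M N
    ƛ    : ∀ {A M M′} → Compatible R M M′ → Compatible R (ƛ A M) (ƛ A M′)
    ·ˡ   : ∀ {M M′ N} → Compatible R M M′ → Compatible R (M · N) (M′ · N)
    ·ʳ   : ∀ {M N N′} → Compatible R N N′ → Compatible R (M · N) (M · N′)
    ⟨⟩ˡ  : ∀ {M M′ N} → Compatible R M M′ → Compatible R ⟨ M , N ⟩ ⟨ M′ , N ⟩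
    ⟨⟩ʳ  : ∀ {M N N′} → Compatible R N N′ → Compatible R ⟨ M , N ⟩ ⟨ M , N′ ⟩
    proj : ∀ {i M M′} → Compatible R M M′ → Compatible R (proj i M) (proj i M′)
    Λ    : ∀ {M M′} → Compatible R M M′ → Compatible R (Λ M) (Λ M′)
    ∙ˡ   : ∀ {M M′ X} → Compatible R M M′ → Compatible R (M ∙ X) (M′ ∙ X)

  infix 4 _⟶β*_ _⟶βη*_

  _⟶β*_ : ∀ {n m} → Rel (Term n m) 0ℓ
  _⟶β*_ = Star (Compatible β)

  _⟶βη*_ : ∀ {n m} → Rel (Term n m) 0ℓ
  _⟶βη*_ = Star (Compatible βη)

  _∨_ : ∀ {n} → Type n → Type n → Type n
  A ∨ B = ∀′ (((wkType A ⊃ ` zero) ∧ (wkType B ⊃ ` zero)) ⊃ ` zero)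

  ⊥ : ∀ {n} → Type n
  ⊥ = ∀′ (` zero)

  ƛ̲ : ∀ {n m} → Type n → Term n (suc m) → Term n m
  ƛ̲ A M = ƛ A (wk (ƛ A M) · var zero)

  ⟪_,_⟫ : ∀ {n m} → Term n m → Term n m → Term n m
  ⟪ M , N ⟫ = ⟨ proj one ⟨ M , N ⟩ , proj two ⟨ M , N ⟩ ⟩

  _＠_ : ∀ {n m} → Term n m → Term n m → Term n m
  ƛ A P ＠ N = P [ N ]
  M     ＠ N = M · N

  ＠proj : ∀ {n m} → Side → Term n m → Term n m
  ＠proj i ⟨ N₁ , N₂ ⟩ = pick i N₁ N₂
  ＠proj i M           = proj i M

  _＠ᵗ_ : ∀ {n m} → Term n m → Fin n → Term n m
  Λ P ＠ᵗ Y = P [ Y ]ᵗ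
  M   ＠ᵗ Y = M ∙ Y

  IN : ∀ {n m} → Side → Term n m → Type n → Type n → Term n m
  IN i M A B =
    Λ (ƛ ((wkType A ⊃ ` zero) ∧ (wkType B ⊃ ` zero))
         (proj i (var zero) · wk (wkᵗ M)))

  -- CASE M A P B Q C is CASE(M, x^A.P, y^B.Q, C).
  CASE : ∀ {n m} → Term n m → Type n → Term n (suc m) →
         Type n → Term n (suc m) → Type n → Term n m
  CASE M A P B Q (` X)     = (M ＠ᵗ X) ＠ ⟨ ƛ A P , ƛ B Q ⟩
  CASE M A P B Q (C₁ ∧ C₂) =
    ⟨ CASE M A (＠proj one P) B (＠proj one Q) C₁
    , CASE M A (＠proj two P) B (＠proj two Q) C₂ ⟩
  CASE M A P B Q (C₁ ⊃ C₂) =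
    ƛ C₁ (CASE (wk M) A (wk₁ P ＠ var (suc zero)) B (wk₁ Q ＠ var (suc zero)) C₂)
  CASE M A P B Q (∀′ C)    =
    Λ (CASE (wkᵗ M) (wkType A) (wkᵗ P ＠ᵗ zero) (wkType B) (wkᵗ Q ＠ᵗ zero) C)

  ABORT : ∀ {n m} → Term n m → Type n → Term n m
  ABORT M (` X)     = M ＠ᵗ X
  ABORT M (A₁ ∧ A₂) = ⟨ ABORT M A₁ , ABORT M A₂ ⟩
  ABORT M (B ⊃ C)   = ƛ B (ABORT (wk M) C)
  ABORT M (∀′ A)    = Λ (ABORT (wkᵗ M) A)

infix 11 _◇ᵗ _◇

_◇ᵗ : ∀ {n} → IPC.Form n → Fat.Type n
(IPC.` X) ◇ᵗ     = Fat.` X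
IPC.⊥ ◇ᵗ         = Fat.⊥
(A IPC.⊃ B) ◇ᵗ   = A ◇ᵗ Fat.⊃ B ◇ᵗ
(A IPC.∧ B) ◇ᵗ   = A ◇ᵗ Fat.∧ B ◇ᵗ
(A IPC.∨ B) ◇ᵗ   = A ◇ᵗ Fat.∨ B ◇ᵗ

_◇ : ∀ {n m} → IPC.Term n m → Fat.Term n m
(IPC.var x) ◇            = Fat.var x
(IPC.ƛ A M) ◇            = Fat.ƛ̲ (A ◇ᵗ) (M ◇)
(M IPC.· N) ◇            = M ◇ Fat.＠ N ◇
IPC.⟨ M , N ⟩ ◇          = Fat.⟪ M ◇ , N ◇ ⟫
(IPC.proj i M) ◇         = Fat.＠proj i (M ◇)
(IPC.inj i M A B) ◇      = Fat.IN i (M ◇) (A ◇ᵗ) (B ◇ᵗ)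
(IPC.case M A P B Q C) ◇ =
  Fat.CASE (M ◇) (A ◇ᵗ) (P ◇) (B ◇ᵗ) (Q ◇) (C ◇ᵗ)
(IPC.abort M A) ◇        = Fat.ABORT (M ◇) (A ◇ᵗ)

module Submission where

-- The optimized operations ＠ commute with a substitution exactly unless the substitution
-- puts an introduction in place of a variable uncovered by stripping. Every translation
-- M ◇ is closed against this: ƛ̲ keeps a bound variable from ever being uncovered. Hence
-- CASE and ABORT commute with elimination by ＠, and the π and ϖ rules become
-- identities by induction on the type C of the CASE or ABORT. For arbitrary substitutions
-- one only has M ◇ [ N ◇ ] ⟶β* (M [ N ]) ◇, which gives the β rules. Finally β∨, η∨ and η⊃
-- rest on ƛ C (M ＠ z) ⟶* M; when M is itself an abstraction this is an equality that needs
-- the annotation of M to be C, and this is what typability of the source term provides.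

open import Defs
open import Data.Bool using (Bool; true; false)
open import Data.Fin using (Fin; zero; suc; lift)
open import Data.List using ([]; _∷_)
open import Data.List.Membership.Propositional using (_∈_)
open import Data.List.Relation.Unary.Any using (here; there)
open import Data.Nat using (ℕ; suc)
open import Data.Product using (_×_; _,_; ∃)
open import Data.Sum using (inj₁; inj₂; [_,_])
open import Data.Vec using (Vec)
open import Data.Vec.Functional using () renaming (_∷_ to _∷ᶠ_)
open import Function using (id; _∘_)
open import Level using (0ℓ)
open import Relation.Binary using (Rel)
open import Relation.Binary.Construct.Closure.ReflexiveTransitive using (Star; ε; _◅_; _◅◅_; gmap)
open import Relation.Binary.PropositionalEquality
  using (_≡_; _≗_; refl; sym; trans; cong; cong₂; subst; subst₂; module ≡-Reasoning)
open IPC using (Term; Form; Rule; β⊃; β∧; β∨; π⊃; π∧; π∨; π⊥; ϖ⊃; ϖ∧; ϖ∨; ϖ⊥; η⊃; η∧; η∨; _⟶[_]_; _⊢_∶_)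
open IPC using (_▷[_]_)
open Fat using (_⟶β*_; _⟶βη*_)
open Fat renaming (Term to Termᵃ)

-- Why abstractions are translated with `ƛ̲`: if the identity became `ƛ A (var zero)`, applying it
-- by `＠` to z and then to y would uncover z and give `z · y`. Putting an abstraction N for z then
-- leaves the redex `N · y`, whereas `(ƛ A (var zero) ＠ N) ＠ y` contracts it. `CASE` creates exactly
-- this situation, since it applies its branches to a fresh z which a later elimination
-- instantiates. With `ƛ̲` the first `＠` yields `ƛ A (var zero) · z`, and every later `＠` merely
-- extends this application. Why typing matters for η⊃: take `abort (var x) (C ⊃ D)` with D an atom
-- X. Its translation is `ƛ` with annotation `C ◇ᵗ` over the instance of the variable at X. Its
-- η-expansion with another annotation A translates to a term whose only normal form has `A ◇ᵗ` in
-- that place, and no reduction changes an annotation.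

private variable
  n n′ m k l : ℕ
  A B C D : Type n
  M M′ N N′ P P′ Q Q′ : Termᵃ n m

-- Substitution calculus of F_at

lift-∘ : {ρ′ : Fin k → Fin l} {ρ : Fin m → Fin k} → lift 1 ρ′ ∘ lift 1 ρ ≗ lift 1 (ρ′ ∘ ρ)
lift-∘ zero    = refl
lift-∘ (suc x) = refl

lift-cong : {ρ ρ′ : Fin m → Fin k} → ρ ≗ ρ′ → lift 1 ρ ≗ lift 1 ρ′
lift-cong e zero    = refl
lift-cong e (suc x) = cong suc (e x)

lift-id : lift {m} 1 id ≗ id
lift-id zero    = refl
lift-id (suc x) = refl

renType-cong : {ρ ρ′ : Fin n → Fin k} → ρ ≗ ρ′ → renType ρ ≗ renType ρ′
renType-cong e (` X)   = cong `_ (e X)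
renType-cong e (A ⊃ B) = cong₂ _⊃_ (renType-cong e A) (renType-cong e B)
renType-cong e (A ∧ B) = cong₂ _∧_ (renType-cong e A) (renType-cong e B)
renType-cong e (∀′ A)  = cong ∀′ (renType-cong (lift-cong e) A)

renType-∘ : (ρ′ : Fin k → Fin l) (ρ : Fin n → Fin k) → renType ρ′ ∘ renType ρ ≗ renType (ρ′ ∘ ρ)
renType-∘ ρ′ ρ (` X)   = refl
renType-∘ ρ′ ρ (A ⊃ B) = cong₂ _⊃_ (renType-∘ ρ′ ρ A) (renType-∘ ρ′ ρ B)
renType-∘ ρ′ ρ (A ∧ B) = cong₂ _∧_ (renType-∘ ρ′ ρ A) (renType-∘ ρ′ ρ B)
renType-∘ ρ′ ρ (∀′ A)  = cong ∀′ (trans (renType-∘ _ _ A) (renType-cong lift-∘ A))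

renType-id : renType {n} id ≗ id
renType-id (` X)   = refl
renType-id (A ⊃ B) = cong₂ _⊃_ (renType-id A) (renType-id B)
renType-id (A ∧ B) = cong₂ _∧_ (renType-id A) (renType-id B)
renType-id (∀′ A)  = cong ∀′ (trans (renType-cong lift-id A) (renType-id A))

renᵗ-cong : {ρ ρ′ : Fin n → Fin k} → ρ ≗ ρ′ → renᵗ {m = m} ρ ≗ renᵗ ρ′
renᵗ-cong e (var x)    = refl
renᵗ-cong e (ƛ A M)    = cong₂ ƛ (renType-cong e A) (renᵗ-cong e M)
renᵗ-cong e (M · N)    = cong₂ _·_ (renᵗ-cong e M) (renᵗ-cong e N)
renᵗ-cong e ⟨ M , N ⟩  = cong₂ ⟨_,_⟩ (renᵗ-cong e M) (renᵗ-cong e N)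
renᵗ-cong e (proj i M) = cong (proj i) (renᵗ-cong e M)
renᵗ-cong e (Λ M)      = cong Λ (renᵗ-cong (lift-cong e) M)
renᵗ-cong e (M ∙ X)    = cong₂ _∙_ (renᵗ-cong e M) (e X)

renᵗ-∘ : (ρ′ : Fin k → Fin l) (ρ : Fin n → Fin k) → renᵗ {m = m} ρ′ ∘ renᵗ ρ ≗ renᵗ (ρ′ ∘ ρ)
renᵗ-∘ ρ′ ρ (var x)    = refl
renᵗ-∘ ρ′ ρ (ƛ A M)    = cong₂ ƛ (renType-∘ ρ′ ρ A) (renᵗ-∘ ρ′ ρ M)
renᵗ-∘ ρ′ ρ (M · N)    = cong₂ _·_ (renᵗ-∘ ρ′ ρ M) (renᵗ-∘ ρ′ ρ N)
renᵗ-∘ ρ′ ρ ⟨ M , N ⟩  = cong₂ ⟨_,_⟩ (renᵗ-∘ ρ′ ρ M) (renᵗ-∘ ρ′ ρ N)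
renᵗ-∘ ρ′ ρ (proj i M) = cong (proj i) (renᵗ-∘ ρ′ ρ M)
renᵗ-∘ ρ′ ρ (Λ M)      = cong Λ (trans (renᵗ-∘ _ _ M) (renᵗ-cong lift-∘ M))
renᵗ-∘ ρ′ ρ (M ∙ X)    = cong (_∙ _) (renᵗ-∘ ρ′ ρ M)

renᵗ-id : renᵗ {n} {m = m} id ≗ id
renᵗ-id (var x)    = refl
renᵗ-id (ƛ A M)    = cong₂ ƛ (renType-id A) (renᵗ-id M)
renᵗ-id (M · N)    = cong₂ _·_ (renᵗ-id M) (renᵗ-id N)
renᵗ-id ⟨ M , N ⟩  = cong₂ ⟨_,_⟩ (renᵗ-id M) (renᵗ-id N)
renᵗ-id (proj i M) = cong (proj i) (renᵗ-id M)
renᵗ-id (Λ M)      = cong Λ (trans (renᵗ-cong lift-id M) (renᵗ-id M))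
renᵗ-id (M ∙ X)    = cong (_∙ X) (renᵗ-id M)

exts-cong : {σ τ : Fin m → Termᵃ n k} → σ ≗ τ → exts σ ≗ exts τ
exts-cong e zero    = refl
exts-cong e (suc x) = cong wk (e x)

sub-cong : {σ τ : Fin m → Termᵃ n k} → σ ≗ τ → sub σ ≗ sub τ
sub-cong e (var x)    = e x
sub-cong e (ƛ A M)    = cong (ƛ A) (sub-cong (exts-cong e) M)
sub-cong e (M · N)    = cong₂ _·_ (sub-cong e M) (sub-cong e N)
sub-cong e ⟨ M , N ⟩  = cong₂ ⟨_,_⟩ (sub-cong e M) (sub-cong e N)
sub-cong e (proj i M) = cong (proj i) (sub-cong e M)
sub-cong e (Λ M)      = cong Λ (sub-cong (λ x → cong wkᵗ (e x)) M)
sub-cong e (M ∙ X)    = cong (_∙ X) (sub-cong e M)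

exts-var : (ρ : Fin m → Fin k) → exts {n} (var ∘ ρ) ≗ var ∘ lift 1 ρ
exts-var ρ zero    = refl
exts-var ρ (suc x) = refl

ren≡sub : (ρ : Fin m → Fin k) → ren {n} ρ ≗ sub (var ∘ ρ)
ren≡sub ρ (var x)    = refl
ren≡sub ρ (ƛ A M)    = cong (ƛ A) (trans (ren≡sub _ M) (sub-cong (sym ∘ exts-var ρ) M))
ren≡sub ρ (M · N)    = cong₂ _·_ (ren≡sub ρ M) (ren≡sub ρ N)
ren≡sub ρ ⟨ M , N ⟩  = cong₂ ⟨_,_⟩ (ren≡sub ρ M) (ren≡sub ρ N)
ren≡sub ρ (proj i M) = cong (proj i) (ren≡sub ρ M)
ren≡sub ρ (Λ M)      = cong Λ (ren≡sub ρ M)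
ren≡sub ρ (M ∙ X)    = cong (_∙ X) (ren≡sub ρ M)

exts-lift : (σ : Fin k → Termᵃ n l) (ρ : Fin m → Fin k) → exts σ ∘ lift 1 ρ ≗ exts (σ ∘ ρ)
exts-lift σ ρ zero    = refl
exts-lift σ ρ (suc x) = refl

sub-ren : (σ : Fin k → Termᵃ n l) (ρ : Fin m → Fin k) → sub σ ∘ ren ρ ≗ sub (σ ∘ ρ)
sub-ren σ ρ (var x)    = refl
sub-ren σ ρ (ƛ A M)    = cong (ƛ A) (trans (sub-ren _ _ M) (sub-cong (exts-lift σ ρ) M))
sub-ren σ ρ (M · N)    = cong₂ _·_ (sub-ren σ ρ M) (sub-ren σ ρ N)
sub-ren σ ρ ⟨ M , N ⟩  = cong₂ ⟨_,_⟩ (sub-ren σ ρ M) (sub-ren σ ρ N)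
sub-ren σ ρ (proj i M) = cong (proj i) (sub-ren σ ρ M)
sub-ren σ ρ (Λ M)      = cong Λ (sub-ren _ ρ M)
sub-ren σ ρ (M ∙ X)    = cong (_∙ X) (sub-ren σ ρ M)

ren-∘ : (ρ′ : Fin k → Fin l) (ρ : Fin m → Fin k) → ren {n} ρ′ ∘ ren ρ ≗ ren (ρ′ ∘ ρ)
ren-∘ ρ′ ρ M = begin
  ren ρ′ (ren ρ M)          ≡⟨ ren≡sub ρ′ _ ⟩
  sub (var ∘ ρ′) (ren ρ M)  ≡⟨ sub-ren _ ρ M ⟩
  sub (var ∘ ρ′ ∘ ρ) M      ≡⟨ ren≡sub _ M ⟨
  ren (ρ′ ∘ ρ) M            ∎
  where open ≡-Reasoning

renᵗ-ren : (τ : Fin n → Fin n′) (ρ : Fin m → Fin k) → renᵗ τ ∘ ren ρ ≗ ren ρ ∘ renᵗ τ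
renᵗ-ren τ ρ (var x)    = refl
renᵗ-ren τ ρ (ƛ A M)    = cong (ƛ _) (renᵗ-ren τ _ M)
renᵗ-ren τ ρ (M · N)    = cong₂ _·_ (renᵗ-ren τ ρ M) (renᵗ-ren τ ρ N)
renᵗ-ren τ ρ ⟨ M , N ⟩  = cong₂ ⟨_,_⟩ (renᵗ-ren τ ρ M) (renᵗ-ren τ ρ N)
renᵗ-ren τ ρ (proj i M) = cong (proj i) (renᵗ-ren τ ρ M)
renᵗ-ren τ ρ (Λ M)      = cong Λ (renᵗ-ren _ ρ M)
renᵗ-ren τ ρ (M ∙ X)    = cong (_∙ _) (renᵗ-ren τ ρ M)

wk-ren : (ρ : Fin m → Fin k) (M : Termᵃ n m) → ren (lift 1 ρ) (wk M) ≡ wk (ren ρ M)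
wk-ren ρ M = trans (ren-∘ _ suc M) (sym (ren-∘ suc ρ M))

wkᵗ-renᵗ : (ρ : Fin n → Fin k) (M : Termᵃ n m) → renᵗ (lift 1 ρ) (wkᵗ M) ≡ wkᵗ (renᵗ ρ M)
wkᵗ-renᵗ ρ M = trans (renᵗ-∘ _ suc M) (sym (renᵗ-∘ suc ρ M))

wkType-renType : (ρ : Fin n → Fin k) (A : Type n) → renType (lift 1 ρ) (wkType A) ≡ wkType (renType ρ A)
wkType-renType ρ A = trans (renType-∘ _ suc A) (sym (renType-∘ suc ρ A))

ren-exts : (ρ : Fin k → Fin l) (σ : Fin m → Termᵃ n k) → ren (lift 1 ρ) ∘ exts σ ≗ exts (ren ρ ∘ σ)
ren-exts ρ σ zero    = refl
ren-exts ρ σ (suc x) = wk-ren ρ (σ x)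

ren-sub : (ρ : Fin k → Fin l) (σ : Fin m → Termᵃ n k) → ren ρ ∘ sub σ ≗ sub (ren ρ ∘ σ)
ren-sub ρ σ (var x)    = refl
ren-sub ρ σ (ƛ A M)    = cong (ƛ A) (trans (ren-sub _ _ M) (sub-cong (ren-exts ρ σ) M))
ren-sub ρ σ (M · N)    = cong₂ _·_ (ren-sub ρ σ M) (ren-sub ρ σ N)
ren-sub ρ σ ⟨ M , N ⟩  = cong₂ ⟨_,_⟩ (ren-sub ρ σ M) (ren-sub ρ σ N)
ren-sub ρ σ (proj i M) = cong (proj i) (ren-sub ρ σ M)
ren-sub ρ σ (Λ M)      =
  cong Λ (trans (ren-sub ρ _ M) (sub-cong (λ x → sym (renᵗ-ren suc ρ (σ x))) M))
ren-sub ρ σ (M ∙ X)    = cong (_∙ X) (ren-sub ρ σ M)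

renᵗ-exts : (τ : Fin n → Fin n′) (σ : Fin m → Termᵃ n k) → renᵗ τ ∘ exts σ ≗ exts (renᵗ τ ∘ σ)
renᵗ-exts τ σ zero    = refl
renᵗ-exts τ σ (suc x) = renᵗ-ren τ suc (σ x)

renᵗ-sub : (τ : Fin n → Fin n′) (σ : Fin m → Termᵃ n k) → renᵗ τ ∘ sub σ ≗ sub (renᵗ τ ∘ σ) ∘ renᵗ τ
renᵗ-sub τ σ (var x)    = refl
renᵗ-sub τ σ (ƛ A M)    = cong (ƛ _) (trans (renᵗ-sub τ _ M) (sub-cong (renᵗ-exts τ σ) (renᵗ τ M)))
renᵗ-sub τ σ (M · N)    = cong₂ _·_ (renᵗ-sub τ σ M) (renᵗ-sub τ σ N)
renᵗ-sub τ σ ⟨ M , N ⟩  = cong₂ ⟨_,_⟩ (renᵗ-sub τ σ M) (renᵗ-sub τ σ N)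
renᵗ-sub τ σ (proj i M) = cong (proj i) (renᵗ-sub τ σ M)
renᵗ-sub τ σ (Λ M)      =
  cong Λ (trans (renᵗ-sub _ _ M) (sub-cong (λ x → wkᵗ-renᵗ τ (σ x)) (renᵗ (lift 1 τ) M)))
renᵗ-sub τ σ (M ∙ X)    = cong (_∙ _) (renᵗ-sub τ σ M)

sub-exts-wk : (σ : Fin m → Termᵃ n k) (M : Termᵃ n m) → sub (exts σ) (wk M) ≡ wk (sub σ M)
sub-exts-wk σ M = trans (sub-ren _ suc M) (sym (ren-sub suc σ M))

sub-exts-wk₁ : (σ : Fin m → Termᵃ n k) (P : Termᵃ n (suc m)) →
               sub (exts (exts σ)) (wk₁ P) ≡ wk₁ (sub (exts σ) P)
sub-exts-wk₁ σ P = begin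
  sub (exts (exts σ)) (wk₁ P)    ≡⟨ sub-ren _ _ P ⟩
  sub (exts (exts σ) ∘ lift 1 suc) P  ≡⟨ sub-cong (exts-lift _ suc) P ⟩
  sub (exts (wk ∘ σ)) P          ≡⟨ sub-cong (ren-exts suc σ) P ⟨
  sub (wk₁ ∘ exts σ) P           ≡⟨ ren-sub _ _ P ⟨
  wk₁ (sub (exts σ) P)           ∎
  where open ≡-Reasoning

sub-wkᵗ : (σ : Fin m → Termᵃ n k) (M : Termᵃ n m) → sub (wkᵗ ∘ σ) (wkᵗ M) ≡ wkᵗ (sub σ M)
sub-wkᵗ σ M = sym (renᵗ-sub suc σ M)

sub-exts-wkᵗ : (σ : Fin m → Termᵃ n k) (P : Termᵃ n (suc m)) →
               sub (exts (wkᵗ ∘ σ)) (wkᵗ P) ≡ wkᵗ (sub (exts σ) P)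
sub-exts-wkᵗ σ P = trans (sub-cong (sym ∘ renᵗ-exts suc σ) (wkᵗ P)) (sub-wkᵗ (exts σ) P)

sub-exts : (τ : Fin k → Termᵃ n l) (σ : Fin m → Termᵃ n k) → sub (exts τ) ∘ exts σ ≗ exts (sub τ ∘ σ)
sub-exts τ σ zero    = refl
sub-exts τ σ (suc x) = sub-exts-wk τ (σ x)

sub-∘ : (τ : Fin k → Termᵃ n l) (σ : Fin m → Termᵃ n k) → sub τ ∘ sub σ ≗ sub (sub τ ∘ σ)
sub-∘ τ σ (var x)    = refl
sub-∘ τ σ (ƛ A M)    = cong (ƛ A) (trans (sub-∘ _ _ M) (sub-cong (sub-exts τ σ) M))
sub-∘ τ σ (M · N)    = cong₂ _·_ (sub-∘ τ σ M) (sub-∘ τ σ N)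
sub-∘ τ σ ⟨ M , N ⟩  = cong₂ ⟨_,_⟩ (sub-∘ τ σ M) (sub-∘ τ σ N)
sub-∘ τ σ (proj i M) = cong (proj i) (sub-∘ τ σ M)
sub-∘ τ σ (Λ M)      = cong Λ (trans (sub-∘ _ _ M) (sub-cong (λ x → sub-wkᵗ τ (σ x)) M))
sub-∘ τ σ (M ∙ X)    = cong (_∙ X) (sub-∘ τ σ M)

exts-id : exts {n} {m} var ≗ var
exts-id zero    = refl
exts-id (suc x) = refl

sub-var : sub {n} {m} var ≗ id
sub-var (var x)    = refl
sub-var (ƛ A M)    = cong (ƛ A) (trans (sub-cong exts-id M) (sub-var M))
sub-var (M · N)    = cong₂ _·_ (sub-var M) (sub-var N)
sub-var ⟨ M , N ⟩  = cong₂ ⟨_,_⟩ (sub-var M) (sub-var N)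
sub-var (proj i M) = cong (proj i) (sub-var M)
sub-var (Λ M)      = cong Λ (sub-var M)
sub-var (M ∙ X)    = cong (_∙ X) (sub-var M)

wk-[] : (M N : Termᵃ n m) → wk M [ N ] ≡ M
wk-[] M N = trans (sub-ren _ suc M) (sub-var M)

wkᵗ-[]ᵗ : (M : Termᵃ n m) (Y : Fin n) → wkᵗ M [ Y ]ᵗ ≡ M
wkᵗ-[]ᵗ M Y = trans (renᵗ-∘ _ suc M) (renᵗ-id M)

wkType-inst : (A : Type n) (Y : Fin n) → renType (Y ∷ᶠ id) (wkType A) ≡ A
wkType-inst A Y = trans (renType-∘ _ suc A) (renType-id A)

exts-[]-wk₁ : (P : Termᵃ n (suc m)) (N : Termᵃ n m) → sub (exts (N ∷ᶠ var)) (wk₁ P) ≡ P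
exts-[]-wk₁ P N = trans (sub-ren _ _ P) (trans (sub-cong e P) (sub-var P))
  where
  e : exts (N ∷ᶠ var) ∘ lift 1 suc ≗ var
  e zero    = refl
  e (suc x) = refl

sub-[] : (σ : Fin m → Termᵃ n k) (P : Termᵃ n (suc m)) (N : Termᵃ n m) →
         sub σ (P [ N ]) ≡ sub (exts σ) P [ sub σ N ]
sub-[] σ P N = trans (sub-∘ _ _ P) (trans (sub-cong e P) (sym (sub-∘ _ _ P)))
  where
  e : sub σ ∘ (N ∷ᶠ var) ≗ sub (sub σ N ∷ᶠ var) ∘ exts σ
  e zero    = refl
  e (suc x) = sym (wk-[] (σ x) (sub σ N))

renᵗ-[] : (τ : Fin n → Fin n′) (P : Termᵃ n (suc m)) (N : Termᵃ n m) →
          renᵗ τ (P [ N ]) ≡ renᵗ τ P [ renᵗ τ N ]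
renᵗ-[] τ P N = trans (renᵗ-sub τ _ P) (sub-cong e (renᵗ τ P))
  where
  e : renᵗ τ ∘ (N ∷ᶠ var) ≗ (renᵗ τ N ∷ᶠ var)
  e zero    = refl
  e (suc x) = refl

renᵗ-[]ᵗ : (τ : Fin n → Fin n′) (P : Termᵃ (suc n) m) (Y : Fin n) →
           renᵗ τ (P [ Y ]ᵗ) ≡ renᵗ (lift 1 τ) P [ τ Y ]ᵗ
renᵗ-[]ᵗ τ P Y = trans (renᵗ-∘ _ _ P) (trans (renᵗ-cong e P) (sym (renᵗ-∘ _ _ P)))
  where
  e : τ ∘ (Y ∷ᶠ id) ≗ (τ Y ∷ᶠ id) ∘ lift 1 τ
  e zero    = refl
  e (suc X) = refl

sub-[]ᵗ : (σ : Fin m → Termᵃ n k) (P : Termᵃ (suc n) m) (Y : Fin n) →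
          sub σ (P [ Y ]ᵗ) ≡ sub (wkᵗ ∘ σ) P [ Y ]ᵗ
sub-[]ᵗ σ P Y = sym (trans (renᵗ-sub _ _ P) (sub-cong (λ x → wkᵗ-[]ᵗ (σ x) Y) (P [ Y ]ᵗ)))

-- Exact commutation of the optimized operations with renaming and substitution

-- Repeated use of ＠, ＠proj and ＠ᵗ strips the introductions from the front of M.
-- Guarded V M says that the only free variables this can uncover are the x
-- with V x ≡ true; a variable bound by a stripped ƛ must not be uncovered at all,
-- as it may be instantiated by anything.
data Guarded {n m} (V : Fin m → Bool) : Termᵃ n m → Set where
  var  : ∀ {x} → V x ≡ true → Guarded V (var x)
  ƛ    : Guarded (false ∷ᶠ V) P → Guarded V (ƛ A P)
  _·_  : ∀ M N → Guarded V (M · N)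
  ⟨_,_⟩ : Guarded V M → Guarded V N → Guarded V ⟨ M , N ⟩
  proj : ∀ i M → Guarded V (proj i M)
  Λ    : Guarded V P → Guarded V (Λ P)
  _∙_  : ∀ M X → Guarded V (M ∙ X)

private variable
  V W : Fin m → Bool
  σ : Fin m → Termᵃ n k

all : Fin m → Bool
all _ = true

-- Where `V` is `false`, σ is unrestricted. This is what admits the substitution `N ∷ᶠ var` of an
-- arbitrary N for a bound variable that stripping cannot uncover.
VarOn : (Fin m → Bool) → (Fin k → Bool) → (Fin m → Termᵃ n k) → Set
VarOn V W σ = ∀ x → V x ≡ true → ∃ λ y → σ x ≡ var y × W y ≡ true

exts-varOn : ∀ b → VarOn V W σ → VarOn (b ∷ᶠ V) (b ∷ᶠ W) (exts σ)
exts-varOn b on zero    v = zero , refl , v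
exts-varOn b on (suc x) v with y , e , w ← on x v = suc y , cong wk e , w

wkᵗ-varOn : VarOn V W σ → VarOn V W (wkᵗ ∘ σ)
wkᵗ-varOn on x v with y , e , w ← on x v = y , cong wkᵗ e , w

var-varOn : (ρ : Fin m → Fin k) → VarOn {n = n} all all (var ∘ ρ)
var-varOn ρ x v = ρ x , refl , refl

guarded-sub : VarOn V W σ → Guarded V M → Guarded W (sub σ M)
guarded-sub on (var {x} v) with y , e , w ← on x v = subst (Guarded _) (sym e) (var w)
guarded-sub on (ƛ g)      = ƛ (guarded-sub (exts-varOn false on) g)
guarded-sub on (M · N)    = _ · _
guarded-sub on ⟨ g , h ⟩  = ⟨ guarded-sub on g , guarded-sub on h ⟩
guarded-sub on (proj i M) = proj i _
guarded-sub on (Λ g)      = Λ (guarded-sub (wkᵗ-varOn on) g)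
guarded-sub on (M ∙ X)    = _ ∙ X

guarded-renᵗ : {τ : Fin n → Fin n′} → Guarded V M → Guarded V (renᵗ τ M)
guarded-renᵗ (var v)    = var v
guarded-renᵗ (ƛ g)      = ƛ (guarded-renᵗ g)
guarded-renᵗ (M · N)    = _ · _
guarded-renᵗ ⟨ g , h ⟩  = ⟨ guarded-renᵗ g , guarded-renᵗ h ⟩
guarded-renᵗ (proj i M) = proj i _
guarded-renᵗ (Λ g)      = Λ (guarded-renᵗ g)
guarded-renᵗ (M ∙ X)    = _ ∙ _

guarded-ren : {ρ : Fin m → Fin k} → (∀ x → V x ≡ true → W (ρ x) ≡ true) →
              Guarded V M → Guarded W (ren ρ M)
guarded-ren {M = M} {ρ = ρ} f g = subst (Guarded _) (sym (ren≡sub ρ M))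
  (guarded-sub (λ x v → ρ x , refl , f x v) g)

guarded-mono : (∀ x → V x ≡ true → W x ≡ true) → Guarded V M → Guarded W M
guarded-mono {M = M} f g = subst (Guarded _) (sub-var M) (guarded-sub (λ x v → x , refl , f x v) g)

guarded-wk : ∀ {b} → Guarded V M → Guarded (b ∷ᶠ V) (wk M)
guarded-wk = guarded-ren (λ _ v → v)

guarded-wk₁ : ∀ {b c} → Guarded (b ∷ᶠ V) M → Guarded (b ∷ᶠ c ∷ᶠ V) (wk₁ M)
guarded-wk₁ = guarded-ren λ { zero v → v ; (suc _) v → v }

-- The two predicates agree only pointwise, so the passage goes through monotonicity.
all⇒cons : Guarded all M → Guarded (true ∷ᶠ all) M
all⇒cons = guarded-mono λ { zero _ → refl ; (suc _) _ → refl }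

-- In the case `ƛ g` the bound variable carries `false`: `N` lands only in places that stripping
-- does not reach, whatever `N` is.
guarded-＠ : Guarded V M → Guarded V (M ＠ N)
guarded-＠ (var v)    = _ · _
guarded-＠ (ƛ g)      = guarded-sub (λ { zero () ; (suc x) v → x , refl , v }) g
guarded-＠ (M · N)    = _ · _
guarded-＠ ⟨ g , h ⟩  = _ · _
guarded-＠ (proj i M) = _ · _
guarded-＠ (Λ g)      = _ · _
guarded-＠ (M ∙ X)    = _ · _

guarded-＠proj : ∀ i → Guarded V M → Guarded V (＠proj i M)
guarded-＠proj i (var v)    = proj i _
guarded-＠proj i (ƛ g)      = proj i _
guarded-＠proj i (M · N)    = proj i _
guarded-＠proj one ⟨ g , h ⟩ = g
guarded-＠proj two ⟨ g , h ⟩ = h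
guarded-＠proj i (proj j M) = proj i _
guarded-＠proj i (Λ g)      = proj i _
guarded-＠proj i (M ∙ X)    = proj i _

guarded-＠ᵗ : ∀ {X} → Guarded V M → Guarded V (M ＠ᵗ X)
guarded-＠ᵗ (var v)    = _ ∙ _
guarded-＠ᵗ (ƛ g)      = _ ∙ _
guarded-＠ᵗ (M · N)    = _ ∙ _
guarded-＠ᵗ ⟨ g , h ⟩  = _ ∙ _
guarded-＠ᵗ (proj i M) = _ ∙ _
guarded-＠ᵗ (Λ g)      = guarded-renᵗ g
guarded-＠ᵗ (M ∙ X)    = _ ∙ _

-- The branches, and with them the variables bound by the `ƛ` of the `⊃` clause, end up inside the
-- argument of `＠` at an atomic type, so only what `M` uncovers counts.
guarded-CASE : ∀ C → Guarded V M → Guarded V (CASE M A P B Q C)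
guarded-CASE (` X)   g = guarded-＠ (guarded-＠ᵗ g)
guarded-CASE (C ⊃ D) g = ƛ (guarded-CASE D (guarded-wk g))
guarded-CASE (C ∧ D) g = ⟨ guarded-CASE C g , guarded-CASE D g ⟩
guarded-CASE (∀′ C)  g = Λ (guarded-CASE C (guarded-renᵗ g))

guarded-ABORT : ∀ C → Guarded V M → Guarded V (ABORT M C)
guarded-ABORT (` X)   g = guarded-＠ᵗ g
guarded-ABORT (C ⊃ D) g = ƛ (guarded-ABORT D (guarded-wk g))
guarded-ABORT (C ∧ D) g = ⟨ guarded-ABORT C g , guarded-ABORT D g ⟩
guarded-ABORT (∀′ C)  g = Λ (guarded-ABORT C (guarded-renᵗ g))

guarded-◇ : (M : Term n m) → Guarded all (M ◇)
guarded-◇ (IPC.var x)            = var refl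
guarded-◇ (IPC.ƛ A M)            = ƛ (_ · _)
guarded-◇ (M IPC.· N)            = guarded-＠ (guarded-◇ M)
guarded-◇ IPC.⟨ M , N ⟩          = ⟨ proj _ _ , proj _ _ ⟩
guarded-◇ (IPC.proj i M)         = guarded-＠proj i (guarded-◇ M)
guarded-◇ (IPC.inj i M A B)      = Λ (ƛ (_ · _))
guarded-◇ (IPC.case M A P B Q C) = guarded-CASE (C ◇ᵗ) (guarded-◇ M)
guarded-◇ (IPC.abort M A)        = guarded-ABORT (A ◇ᵗ) (guarded-◇ M)

-- Only a variable at the head could become an introduction, on which the right-hand `＠` would
-- contract while the left-hand side stays an application; `VarOn` excludes this.
sub-＠ : VarOn V W σ → Guarded V M → ∀ N → sub σ (M ＠ N) ≡ sub σ M ＠ sub σ N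
sub-＠ on (var {x} v) N with y , e , _ ← on x v rewrite e = refl
sub-＠ on (ƛ {P = P} g) N = sub-[] _ P N
sub-＠ on (M · N)    _ = refl
sub-＠ on ⟨ g , h ⟩  _ = refl
sub-＠ on (proj i M) _ = refl
sub-＠ on (Λ g)      _ = refl
sub-＠ on (M ∙ X)    _ = refl

sub-＠proj : VarOn V W σ → ∀ i → Guarded V M → sub σ (＠proj i M) ≡ ＠proj i (sub σ M)
sub-＠proj on i (var {x} v) with y , e , _ ← on x v rewrite e = refl
sub-＠proj on i (ƛ g)      = refl
sub-＠proj on i (M · N)    = refl
sub-＠proj on one ⟨ g , h ⟩ = refl
sub-＠proj on two ⟨ g , h ⟩ = refl
sub-＠proj on i (proj j M) = refl
sub-＠proj on i (Λ g)      = refl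
sub-＠proj on i (M ∙ X)    = refl

sub-＠ᵗ : VarOn V W σ → Guarded V M → ∀ X → sub σ (M ＠ᵗ X) ≡ sub σ M ＠ᵗ X
sub-＠ᵗ on (var {x} v) X with y , e , _ ← on x v rewrite e = refl
sub-＠ᵗ on (ƛ g)      _ = refl
sub-＠ᵗ on (M · N)    _ = refl
sub-＠ᵗ on ⟨ g , h ⟩  _ = refl
sub-＠ᵗ on (proj i M) _ = refl
sub-＠ᵗ {σ = σ} on (Λ {P = P} g) X = sub-[]ᵗ σ P X
sub-＠ᵗ on (M ∙ X)    _ = refl

-- Renaming type variables preserves the outermost constructor of every term, so `＠` takes the same
-- clause on both sides.
renᵗ-＠ : (τ : Fin n → Fin n′) (M N : Termᵃ n m) → renᵗ τ (M ＠ N) ≡ renᵗ τ M ＠ renᵗ τ N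
renᵗ-＠ τ (var x)    N = refl
renᵗ-＠ τ (ƛ A P)    N = renᵗ-[] τ P N
renᵗ-＠ τ (M · M′)   N = refl
renᵗ-＠ τ ⟨ M , M′ ⟩ N = refl
renᵗ-＠ τ (proj i M) N = refl
renᵗ-＠ τ (Λ M)      N = refl
renᵗ-＠ τ (M ∙ X)    N = refl

renᵗ-＠proj : (τ : Fin n → Fin n′) → ∀ i (M : Termᵃ n m) → renᵗ τ (＠proj i M) ≡ ＠proj i (renᵗ τ M)
renᵗ-＠proj τ i (var x)      = refl
renᵗ-＠proj τ i (ƛ A P)      = refl
renᵗ-＠proj τ i (M · M′)     = refl
renᵗ-＠proj τ one ⟨ M , M′ ⟩ = refl
renᵗ-＠proj τ two ⟨ M , M′ ⟩ = refl
renᵗ-＠proj τ i (proj j M)   = refl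
renᵗ-＠proj τ i (Λ M)        = refl
renᵗ-＠proj τ i (M ∙ X)      = refl

renᵗ-＠ᵗ : (τ : Fin n → Fin n′) (M : Termᵃ n m) → ∀ X → renᵗ τ (M ＠ᵗ X) ≡ renᵗ τ M ＠ᵗ τ X
renᵗ-＠ᵗ τ (var x)    X = refl
renᵗ-＠ᵗ τ (ƛ A P)    X = refl
renᵗ-＠ᵗ τ (M · M′)   X = refl
renᵗ-＠ᵗ τ ⟨ M , M′ ⟩ X = refl
renᵗ-＠ᵗ τ (proj i M) X = refl
renᵗ-＠ᵗ τ (Λ M)      X = renᵗ-[]ᵗ τ M X
renᵗ-＠ᵗ τ (M ∙ Y)    X = refl

wkᵗ-Λ-＠ᵗ : (P : Termᵃ (suc n) m) → wkᵗ (Λ P) ＠ᵗ zero ≡ P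
wkᵗ-Λ-＠ᵗ P = trans (renᵗ-∘ _ _ P) (trans (renᵗ-cong e P) (renᵗ-id P))
  where
  e : (zero ∷ᶠ id) ∘ lift 1 suc ≗ id
  e zero    = refl
  e (suc X) = refl

-- The premise of the encoded disjunction: `A ∨ B` unfolds to the quantification of
-- `branches A B ⊃ X` over X, which is how its eliminations are computed below.
branches : Type n → Type n → Type (suc n)
branches A B = (wkType A ⊃ ` zero) ∧ (wkType B ⊃ ` zero)

wkType-∨ : (A B : Type n) → wkType (A ∨ B) ≡ wkType A ∨ wkType B
wkType-∨ A B = cong₂ (λ A′ B′ → ∀′ (((A′ ⊃ ` zero) ∧ (B′ ⊃ ` zero)) ⊃ ` zero))
                     (wkType-renType suc A) (wkType-renType suc B)

CASE-≡ : ∀ A B C → M ≡ M′ → P ≡ P′ → Q ≡ Q′ → CASE M A P B Q C ≡ CASE M′ A P′ B Q′ C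
CASE-≡ A B C refl refl refl = refl

ABORT-≡ : ∀ C → M ≡ M′ → ABORT M C ≡ ABORT M′ C
ABORT-≡ C refl = refl

sub-ABORT : VarOn V W σ → Guarded V M → ∀ C → sub σ (ABORT M C) ≡ ABORT (sub σ M) C
sub-ABORT on g (` X)   = sub-＠ᵗ on g X
sub-ABORT {M = M} on g (C ⊃ D) = cong (ƛ C)
  (trans (sub-ABORT (exts-varOn false on) (guarded-wk g) D) (ABORT-≡ D (sub-exts-wk _ M)))
sub-ABORT on g (C ∧ D) = cong₂ ⟨_,_⟩ (sub-ABORT on g C) (sub-ABORT on g D)
sub-ABORT {M = M} on g (∀′ C)  = cong Λ
  (trans (sub-ABORT (wkᵗ-varOn on) (guarded-renᵗ g) C) (ABORT-≡ C (sub-wkᵗ _ M)))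

renᵗ-ABORT : (τ : Fin n → Fin n′) (M : Termᵃ n m) → ∀ C →
             renᵗ τ (ABORT M C) ≡ ABORT (renᵗ τ M) (renType τ C)
renᵗ-ABORT τ M (` X)   = renᵗ-＠ᵗ τ M X
renᵗ-ABORT τ M (C ⊃ D) = cong (ƛ _)
  (trans (renᵗ-ABORT τ (wk M) D) (ABORT-≡ (renType τ D) (renᵗ-ren τ suc M)))
renᵗ-ABORT τ M (C ∧ D) = cong₂ ⟨_,_⟩ (renᵗ-ABORT τ M C) (renᵗ-ABORT τ M D)
renᵗ-ABORT τ M (∀′ C)  = cong Λ
  (trans (renᵗ-ABORT _ (wkᵗ M) C) (ABORT-≡ (renType (lift 1 τ) C) (wkᵗ-renᵗ τ M)))

-- The branch variables carry `true`: they remain bound in `ƛ A P` and `ƛ B Q`, so σ reaches them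
-- only as `exts σ`, which maps them to variables.
sub-CASE : VarOn V W σ → Guarded V M → Guarded (true ∷ᶠ V) P → Guarded (true ∷ᶠ V) Q → ∀ A B C →
           sub σ (CASE M A P B Q C) ≡ CASE (sub σ M) A (sub (exts σ) P) B (sub (exts σ) Q) C
sub-CASE on g p q A B (` X) =
  trans (sub-＠ on (guarded-＠ᵗ g) _) (cong (_＠ _) (sub-＠ᵗ on g X))
sub-CASE {V = V} {W = W} {σ = σ} {M = M} {P = P} {Q = Q} on g p q A B (C ⊃ D) = cong (ƛ C)
  (trans (sub-CASE on₁ (guarded-wk g) (guarded-＠ (guarded-wk₁ p)) (guarded-＠ (guarded-wk₁ q)) A B D)
         (CASE-≡ A B D (sub-exts-wk σ M) (branch p) (branch q)))
  where
  on₁ : VarOn (true ∷ᶠ V) (true ∷ᶠ W) (exts σ)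
  on₁ = exts-varOn true on
  branch : Guarded (true ∷ᶠ V) P′ →
           sub (exts (exts σ)) (wk₁ P′ ＠ var (suc zero)) ≡ wk₁ (sub (exts σ) P′) ＠ var (suc zero)
  branch {P′ = P′} p = trans (sub-＠ (exts-varOn true on₁) (guarded-wk₁ p) _)
                             (cong (_＠ var (suc zero)) (sub-exts-wk₁ σ P′))
sub-CASE on g p q A B (C ∧ D) = cong₂ ⟨_,_⟩
  (trans (sub-CASE on g (guarded-＠proj one p) (guarded-＠proj one q) A B C)
         (CASE-≡ A B C refl (sub-＠proj on₁ one p) (sub-＠proj on₁ one q)))
  (trans (sub-CASE on g (guarded-＠proj two p) (guarded-＠proj two q) A B D)
         (CASE-≡ A B D refl (sub-＠proj on₁ two p) (sub-＠proj on₁ two q)))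
  where
  on₁ = exts-varOn true on
sub-CASE {V = V} {σ = σ} {M = M} {P = P} {Q = Q} on g p q A B (∀′ C) = cong Λ
  (trans (sub-CASE (wkᵗ-varOn on) (guarded-renᵗ g) (guarded-＠ᵗ (guarded-renᵗ p))
                   (guarded-＠ᵗ (guarded-renᵗ q)) (wkType A) (wkType B) C)
         (CASE-≡ (wkType A) (wkType B) C (sub-wkᵗ σ M) (branch p) (branch q)))
  where
  branch : Guarded (true ∷ᶠ V) P′ →
           sub (exts (wkᵗ ∘ σ)) (wkᵗ P′ ＠ᵗ zero) ≡ wkᵗ (sub (exts σ) P′) ＠ᵗ zero
  branch {P′ = P′} p = trans (sub-＠ᵗ (exts-varOn true (wkᵗ-varOn on)) (guarded-renᵗ p) zero)
                             (cong (_＠ᵗ zero) (sub-exts-wkᵗ σ P′))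

renᵗ-wk₁-＠ : (τ : Fin n → Fin n′) (P : Termᵃ n (suc m)) → ∀ x →
              renᵗ τ (wk₁ P ＠ var x) ≡ wk₁ (renᵗ τ P) ＠ var x
renᵗ-wk₁-＠ τ P x = trans (renᵗ-＠ τ (wk₁ P) _) (cong (_＠ var x) (renᵗ-ren τ _ P))

renᵗ-wkᵗ-＠ᵗ : (τ : Fin n → Fin n′) (P : Termᵃ n m) →
               renᵗ (lift 1 τ) (wkᵗ P ＠ᵗ zero) ≡ wkᵗ (renᵗ τ P) ＠ᵗ zero
renᵗ-wkᵗ-＠ᵗ τ P = trans (renᵗ-＠ᵗ _ (wkᵗ P) _) (cong (_＠ᵗ zero) (wkᵗ-renᵗ τ P))

renᵗ-CASE : (τ : Fin n → Fin n′) → ∀ (M : Termᵃ n m) A P B Q C →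
            renᵗ τ (CASE M A P B Q C) ≡
            CASE (renᵗ τ M) (renType τ A) (renᵗ τ P) (renType τ B) (renᵗ τ Q) (renType τ C)
renᵗ-CASE τ M A P B Q (` X)   =
  trans (renᵗ-＠ τ (M ＠ᵗ X) _) (cong (_＠ _) (renᵗ-＠ᵗ τ M X))
renᵗ-CASE τ M A P B Q (C ⊃ D) = cong (ƛ _)
  (trans (renᵗ-CASE τ (wk M) A _ B _ D)
         (CASE-≡ _ _ (renType τ D) (renᵗ-ren τ suc M)
                 (renᵗ-wk₁-＠ τ P (suc zero)) (renᵗ-wk₁-＠ τ Q (suc zero))))
renᵗ-CASE τ M A P B Q (C ∧ D) = cong₂ ⟨_,_⟩
  (trans (renᵗ-CASE τ M A _ B _ C)
         (CASE-≡ _ _ (renType τ C) refl (renᵗ-＠proj τ one P) (renᵗ-＠proj τ one Q)))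
  (trans (renᵗ-CASE τ M A _ B _ D)
         (CASE-≡ _ _ (renType τ D) refl (renᵗ-＠proj τ two P) (renᵗ-＠proj τ two Q)))
renᵗ-CASE τ M A P B Q (∀′ C) = cong Λ
  (trans (renᵗ-CASE τ′ (wkᵗ M) (wkType A) _ (wkType B) _ C)
  (trans (CASE-≡ _ _ (renType τ′ C) (wkᵗ-renᵗ τ M) (renᵗ-wkᵗ-＠ᵗ τ P) (renᵗ-wkᵗ-＠ᵗ τ Q))
         (cong₂ (λ A′ B′ → CASE (wkᵗ (renᵗ τ M)) A′ (wkᵗ (renᵗ τ P) ＠ᵗ zero)
                                B′ (wkᵗ (renᵗ τ Q) ＠ᵗ zero) (renType τ′ C))
                (wkType-renType τ A) (wkType-renType τ B))))
  where τ′ = lift 1 τ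

ren-＠ : (ρ : Fin m → Fin k) → Guarded all M → ∀ N → ren ρ (M ＠ N) ≡ ren ρ M ＠ ren ρ N
ren-＠ {M = M} ρ g N = trans (ren≡sub ρ _) (trans (sub-＠ (var-varOn ρ) g N)
  (sym (cong₂ _＠_ (ren≡sub ρ M) (ren≡sub ρ N))))

ren-＠ᵗ : (ρ : Fin m → Fin k) → Guarded all M → ∀ X → ren ρ (M ＠ᵗ X) ≡ ren ρ M ＠ᵗ X
ren-＠ᵗ {M = M} ρ g X = trans (ren≡sub ρ _) (trans (sub-＠ᵗ (var-varOn ρ) g X)
  (sym (cong (_＠ᵗ X) (ren≡sub ρ M))))

ren-＠proj : (ρ : Fin m → Fin k) → ∀ i → Guarded all M → ren ρ (＠proj i M) ≡ ＠proj i (ren ρ M)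
ren-＠proj {M = M} ρ i g = trans (ren≡sub ρ _) (trans (sub-＠proj (var-varOn ρ) i g)
  (sym (cong (＠proj i) (ren≡sub ρ M))))

ren-ABORT : (ρ : Fin m → Fin k) → Guarded all M → ∀ C → ren ρ (ABORT M C) ≡ ABORT (ren ρ M) C
ren-ABORT {M = M} ρ g C = trans (ren≡sub ρ _) (trans (sub-ABORT (var-varOn ρ) g C)
  (sym (ABORT-≡ C (ren≡sub ρ M))))

ren-CASE : (ρ : Fin m → Fin k) → Guarded all M → Guarded all P → Guarded all Q → ∀ A B C →
           ren ρ (CASE M A P B Q C) ≡ CASE (ren ρ M) A (ren (lift 1 ρ) P) B (ren (lift 1 ρ) Q) C
ren-CASE {M = M} ρ g p q A B C =
  trans (ren≡sub ρ _) (trans (sub-CASE (var-varOn ρ) g (all⇒cons p) (all⇒cons q) A B C)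
        (sym (CASE-≡ A B C (ren≡sub ρ M) (branch _) (branch _))))
  where
  branch : ren {n} (lift 1 ρ) ≗ sub (exts (var ∘ ρ))
  branch P = trans (ren≡sub _ P) (sub-cong (sym ∘ exts-var ρ) P)

-- An equality, in contrast to `sub-◇`: variables go to variables, so no `＠` inside the translation
-- meets a new introduction.
ren-◇ : (ρ : Fin m → Fin k) (M : Term n m) → ren ρ (M ◇) ≡ IPC.ren ρ M ◇
ren-◇ ρ (IPC.var x)       = refl
ren-◇ ρ (IPC.ƛ A M)       = cong (λ N → ƛ (A ◇ᵗ) (N · var zero))
  (trans (wk-ren ρ (ƛ _ (M ◇))) (cong (λ N → wk (ƛ _ N)) (ren-◇ _ M)))
ren-◇ ρ (M IPC.· N)       = trans (ren-＠ ρ (guarded-◇ M) _) (cong₂ _＠_ (ren-◇ ρ M) (ren-◇ ρ N))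
ren-◇ ρ IPC.⟨ M , N ⟩     = cong₂ ⟪_,_⟫ (ren-◇ ρ M) (ren-◇ ρ N)
ren-◇ ρ (IPC.proj i M)    = trans (ren-＠proj ρ i (guarded-◇ M)) (cong (＠proj i) (ren-◇ ρ M))
ren-◇ ρ (IPC.inj i M A B) = cong (λ N → Λ (ƛ _ (proj i (var zero) · N)))
  (trans (wk-ren ρ (wkᵗ (M ◇))) (cong wk (trans (sym (renᵗ-ren suc ρ (M ◇))) (cong wkᵗ (ren-◇ ρ M)))))
ren-◇ ρ (IPC.case M A P B Q C) =
  trans (ren-CASE ρ (guarded-◇ M) (guarded-◇ P) (guarded-◇ Q) (A ◇ᵗ) (B ◇ᵗ) (C ◇ᵗ))
        (CASE-≡ (A ◇ᵗ) (B ◇ᵗ) (C ◇ᵗ) (ren-◇ ρ M) (ren-◇ _ P) (ren-◇ _ Q))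
ren-◇ ρ (IPC.abort M A)   =
  trans (ren-ABORT ρ (guarded-◇ M) (A ◇ᵗ)) (ABORT-≡ (A ◇ᵗ) (ren-◇ ρ M))

-- Commuting conversions

guarded-ren-all : {ρ : Fin m → Fin k} → Guarded all M → Guarded all (ren ρ M)
guarded-ren-all = guarded-ren (λ _ v → v)

-- `N` replaces a variable that does not occur in `wk M`, so `sub-ABORT` applies with `false` at
-- that variable and `N` simply vanishes.
ABORT-＠ : Guarded all M → ∀ C D N → ABORT M (C ⊃ D) ＠ N ≡ ABORT M D
ABORT-＠ {M = M} g C D N =
  trans (sub-ABORT {V = false ∷ᶠ all} {W = all} (λ { zero () ; (suc x) _ → x , refl , refl })
                   (guarded-wk g) D)
        (ABORT-≡ D (wk-[] M N))

ABORT-＠ᵗ : ∀ (M : Termᵃ n m) C X → ABORT M (∀′ C) ＠ᵗ X ≡ ABORT M (renType (X ∷ᶠ id) C)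
ABORT-＠ᵗ M C X = trans (renᵗ-ABORT _ (wkᵗ M) C) (ABORT-≡ (renType (X ∷ᶠ id) C) (wkᵗ-[]ᵗ M X))

-- The variable z bound by the `⊃` clause occurs in the branches only as the argument in
-- `wk₁ P ＠ z`. As `P` is guarded, this never brings z to the front, so z may be flagged `false` and
-- replaced by an arbitrary `N` with exact commutation.
CASE-＠ : Guarded all M → Guarded all P → Guarded all Q → ∀ A B C D N →
         CASE M A P B Q (C ⊃ D) ＠ N ≡ CASE M A (P ＠ wk N) B (Q ＠ wk N) D
CASE-＠ {M = M} g p q A B C D N =
  trans (sub-CASE on (guarded-wk g) (branch-guarded p) (branch-guarded q) A B D)
        (CASE-≡ A B D (wk-[] M N) (branch p) (branch q))
  where
  on : VarOn (false ∷ᶠ all) all (N ∷ᶠ var)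
  on zero    ()
  on (suc x) _ = x , refl , refl
  branch-guarded : Guarded all P′ → Guarded (true ∷ᶠ false ∷ᶠ all) (wk₁ P′ ＠ N′)
  branch-guarded p = guarded-＠ (guarded-wk₁ (all⇒cons p))
  branch : Guarded all P′ → sub (exts (N ∷ᶠ var)) (wk₁ P′ ＠ var (suc zero)) ≡ P′ ＠ wk N
  branch {P′ = P′} p = trans (sub-＠ (exts-varOn true on) (guarded-wk₁ (all⇒cons p)) _)
                             (cong (_＠ wk N) (exts-[]-wk₁ P′ N))

CASE-＠ᵗ : ∀ (M : Termᵃ n m) A P B Q C X →
          CASE M A P B Q (∀′ C) ＠ᵗ X ≡ CASE M A (P ＠ᵗ X) B (Q ＠ᵗ X) (renType (X ∷ᶠ id) C)
CASE-＠ᵗ M A P B Q C X =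
  trans (renᵗ-CASE _ (wkᵗ M) (wkType A) _ (wkType B) _ C)
  (trans (CASE-≡ _ _ C′ (wkᵗ-[]ᵗ M X) (branch P) (branch Q))
         (cong₂ (λ A′ B′ → CASE M A′ (P ＠ᵗ X) B′ (Q ＠ᵗ X) C′) (wkType-inst A X) (wkType-inst B X)))
  where
  C′ = renType (X ∷ᶠ id) C
  branch : ∀ P → renᵗ (X ∷ᶠ id) (wkᵗ P ＠ᵗ zero) ≡ P ＠ᵗ X
  branch P = trans (renᵗ-＠ᵗ _ (wkᵗ P) zero) (cong (_＠ᵗ X) (wkᵗ-[]ᵗ P X))

-- Disjunction is a quantified implication, so its elimination is an instantiation followed by an
-- application; both move into the branches, and a `CASE` at an atomic type remains.
CASE-∨-elim : Guarded all M → Guarded all P → Guarded all Q → ∀ A B C D X N →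
              (CASE M A P B Q (C ∨ D) ＠ᵗ X) ＠ N ≡
              CASE M A ((P ＠ᵗ X) ＠ wk N) B ((Q ＠ᵗ X) ＠ wk N) (` X)
CASE-∨-elim {M = M} {P = P} {Q = Q} g p q A B C D X N =
  trans (cong (_＠ N) (CASE-＠ᵗ M A P B Q (branches C D ⊃ ` zero) X))
        (CASE-＠ g (guarded-＠ᵗ p) (guarded-＠ᵗ q) A B (renType (X ∷ᶠ id) (branches C D)) (` X) N)

-- Induction on `E`, the type on which the outer `CASE` recurs; the inner one stays folded. At an
-- atom the outer `CASE` is an elimination of `C ∨ D` by the pair of its branches, and `CASE-∨-elim`
-- pushes it inside.
CASE-CASE : {M : Termᵃ n m} {P′ Q′ P Q : Termᵃ n (suc m)} →
            Guarded all M → Guarded all P′ → Guarded all Q′ → Guarded all P → Guarded all Q →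
            ∀ A B C D E →
            CASE (CASE M A P′ B Q′ (C ∨ D)) C P D Q E ≡
            CASE M A (CASE P′ C (wk₁ P) D (wk₁ Q) E) B (CASE Q′ C (wk₁ P) D (wk₁ Q) E) E
CASE-CASE g p′ q′ p q A B C D (` X) = CASE-∨-elim g p′ q′ A B C D X _
CASE-CASE {n} {m} {P = P} {Q = Q} g p′ q′ p q A B C D (E ⊃ F) = cong (ƛ E)
  (trans (CASE-≡ C D F (ren-CASE suc g p′ q′ A B (C ∨ D)) refl refl)
  (trans (CASE-CASE (guarded-ren-all g) (guarded-ren-all p′) (guarded-ren-all q′)
                    (guarded-＠ (guarded-ren-all p)) (guarded-＠ (guarded-ren-all q)) A B C D F)
         (CASE-≡ A B F refl (branch p′) (branch q′))))
  where
  -- Both sides place the outer branch variable at index 1 and z at index 2; they differ in the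
  -- order in which the two are inserted.
  inner : {P : Termᵃ n (suc m)} → Guarded all P →
          wk₁ (wk₁ P ＠ var (suc zero)) ≡ ren (lift 1 (lift 1 suc)) (wk₁ P) ＠ var (suc (suc zero))
  inner {P} p = trans (ren-＠ (lift 1 suc) (guarded-ren-all p) _) (cong (_＠ var (suc (suc zero)))
    (trans (ren-∘ _ _ P) (trans (trans (ren≡sub _ P) (trans (sub-cong e P) (sym (ren≡sub _ P))))
           (sym (ren-∘ _ _ P)))))
    where
    e : ∀ x → var (lift 1 suc (lift 1 suc x)) ≡ var {n} (lift 1 (lift 1 suc) (lift 1 suc x))
    e zero    = refl
    e (suc x) = refl
  -- On the right, the `⊃` clause of the outer `CASE` applies the whole inner branch to z; `CASE-＠`
  -- carries this application to the branches of that inner `CASE`.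
  branch : {P′ : Termᵃ n (suc m)} → Guarded all P′ →
           CASE (wk₁ P′) C (wk₁ (wk₁ P ＠ var (suc zero))) D (wk₁ (wk₁ Q ＠ var (suc zero))) F ≡
           wk₁ (CASE P′ C (wk₁ P) D (wk₁ Q) (E ⊃ F)) ＠ var (suc zero)
  branch {P′} p′ = sym
    (trans (cong (_＠ var (suc zero))
                 (ren-CASE (lift 1 suc) p′ (guarded-ren-all p) (guarded-ren-all q) C D (E ⊃ F)))
    (trans (CASE-＠ (guarded-ren-all p′) (guarded-ren-all (guarded-ren-all p))
                    (guarded-ren-all (guarded-ren-all q)) C D E F (var (suc zero)))
           (CASE-≡ C D F refl (sym (inner p)) (sym (inner q)))))
CASE-CASE g p′ q′ p q A B C D (E ∧ F) = cong₂ ⟨_,_⟩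
  (trans (CASE-CASE g p′ q′ (guarded-＠proj one p) (guarded-＠proj one q) A B C D E)
         (CASE-≡ A B E refl (branch one E) (branch one E)))
  (trans (CASE-CASE g p′ q′ (guarded-＠proj two p) (guarded-＠proj two q) A B C D F)
         (CASE-≡ A B F refl (branch two F) (branch two F)))
  where
  branch = λ {P′} i E →
    CASE-≡ {M = P′} C D E refl (ren-＠proj (lift 1 suc) i p) (ren-＠proj (lift 1 suc) i q)
CASE-CASE {n} {m} {M} {P′} {Q′} {P} {Q} g p′ q′ p q A B C D (∀′ E) = cong Λ
  (trans (CASE-≡ C′ D′ E
            (trans (renᵗ-CASE suc M A P′ B Q′ (C ∨ D))
                   (cong (CASE (wkᵗ M) (wkType A) (wkᵗ P′) (wkType B) (wkᵗ Q′)) (wkType-∨ C D)))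
            refl refl)
  (trans (CASE-CASE (guarded-renᵗ g) (guarded-renᵗ p′) (guarded-renᵗ q′)
                    (guarded-＠ᵗ (guarded-renᵗ p)) (guarded-＠ᵗ (guarded-renᵗ q))
                    (wkType A) (wkType B) C′ D′ E)
         (CASE-≡ (wkType A) (wkType B) E refl (branch P′) (branch Q′))))
  where
  C′ = wkType C
  D′ = wkType D
  inner : {P : Termᵃ n (suc m)} → Guarded all P → wk₁ (wkᵗ P ＠ᵗ zero) ≡ wkᵗ (wk₁ P) ＠ᵗ zero
  inner {P} p = trans (ren-＠ᵗ (lift 1 suc) (guarded-renᵗ p) zero)
                      (cong (_＠ᵗ zero) (sym (renᵗ-ren suc _ P)))
  branch : (P′ : Termᵃ n (suc m)) →
           CASE (wkᵗ P′) C′ (wk₁ (wkᵗ P ＠ᵗ zero)) D′ (wk₁ (wkᵗ Q ＠ᵗ zero)) E ≡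
           wkᵗ (CASE P′ C (wk₁ P) D (wk₁ Q) (∀′ E)) ＠ᵗ zero
  branch P′ = trans (CASE-≡ C′ D′ E refl (inner p) (inner q)) (sym (wkᵗ-Λ-＠ᵗ _))

-- At an atom X, `ABORT` is instantiation by X, and `⊥` is a quantified variable, so `CASE-＠ᵗ`
-- already gives the claim. At other types `ABORT` unfolds on both sides, and stripping the `ABORT`
-- in each branch undoes its unfolding.
ABORT-CASE : {M : Termᵃ n m} {P Q : Termᵃ n (suc m)} →
             Guarded all M → Guarded all P → Guarded all Q → ∀ A B C →
             ABORT (CASE M A P B Q ⊥) C ≡ CASE M A (ABORT P C) B (ABORT Q C) C
ABORT-CASE {M = M} {P = P} {Q = Q} g p q A B (` X) = CASE-＠ᵗ M A P B Q (` zero) X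
ABORT-CASE {n} {m} {M = M} g p q A B (C ⊃ D) = cong (ƛ C)
  (trans (ABORT-≡ D (ren-CASE suc g p q A B ⊥))
  (trans (ABORT-CASE (guarded-ren-all g) (guarded-ren-all p) (guarded-ren-all q) A B D)
         (CASE-≡ A B D refl (branch p) (branch q))))
  where
  branch : {P : Termᵃ n (suc m)} → Guarded all P →
           ABORT (wk₁ P) D ≡ wk₁ (ABORT P (C ⊃ D)) ＠ var (suc zero)
  branch p = sym (trans (cong (_＠ var (suc zero)) (ren-ABORT (lift 1 suc) p (C ⊃ D)))
                        (ABORT-＠ (guarded-ren-all p) C D (var (suc zero))))
ABORT-CASE g p q A B (C ∧ D) = cong₂ ⟨_,_⟩ (ABORT-CASE g p q A B C) (ABORT-CASE g p q A B D)
ABORT-CASE {M = M} {P = P} {Q = Q} g p q A B (∀′ C) = cong Λ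
  (trans (ABORT-≡ C (renᵗ-CASE suc M A P B Q ⊥))
  (trans (ABORT-CASE (guarded-renᵗ g) (guarded-renᵗ p) (guarded-renᵗ q) (wkType A) (wkType B) C)
         (CASE-≡ (wkType A) (wkType B) C refl (sym (wkᵗ-Λ-＠ᵗ _)) (sym (wkᵗ-Λ-＠ᵗ _)))))

-- At an atom X the instantiation turns `ABORT` at `C ∨ D` into `ABORT` at an implication with
-- conclusion X; applying that to the pair of branches discards the pair.
CASE-ABORT : Guarded all M → ∀ P Q C D E → CASE (ABORT M (C ∨ D)) C P D Q E ≡ ABORT M E
CASE-ABORT {M = M} g P Q C D (` X) =
  trans (cong (_＠ ⟨ ƛ C P , ƛ D Q ⟩) (ABORT-＠ᵗ M (branches C D ⊃ ` zero) X))
        (ABORT-＠ g (renType (X ∷ᶠ id) (branches C D)) (` X) _)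
CASE-ABORT g P Q C D (E ⊃ F) = cong (ƛ E)
  (trans (CASE-≡ C D F (ren-ABORT suc g (C ∨ D)) refl refl)
         (CASE-ABORT (guarded-ren-all g) _ _ C D F))
CASE-ABORT g P Q C D (E ∧ F) = cong₂ ⟨_,_⟩ (CASE-ABORT g _ _ C D E) (CASE-ABORT g _ _ C D F)
CASE-ABORT {M = M} g P Q C D (∀′ E) = cong Λ
  (trans (CASE-≡ (wkType C) (wkType D) E
            (trans (renᵗ-ABORT suc M (C ∨ D)) (cong (ABORT (wkᵗ M)) (wkType-∨ C D))) refl refl)
         (CASE-ABORT (guarded-renᵗ g) _ _ (wkType C) (wkType D) E))

ABORT-ABORT : Guarded all M → ∀ C → ABORT (ABORT M ⊥) C ≡ ABORT M C
ABORT-ABORT {M = M} g (` X) = ABORT-＠ᵗ M (` zero) X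
ABORT-ABORT g (C ⊃ D) = cong (ƛ C)
  (trans (ABORT-≡ D (ren-ABORT suc g ⊥)) (ABORT-ABORT (guarded-ren-all g) D))
ABORT-ABORT g (C ∧ D) = cong₂ ⟨_,_⟩ (ABORT-ABORT g C) (ABORT-ABORT g D)
ABORT-ABORT {M = M} g (∀′ C) = cong Λ
  (trans (ABORT-≡ C (renᵗ-ABORT suc M ⊥)) (ABORT-ABORT (guarded-renᵗ g) C))

-- Reductions in F_at

β-sub : (σ : Fin m → Termᵃ n k) → β M N → β (sub σ M) (sub σ N)
β-sub σ (β⊃ {M = M} {N = N}) = subst (β _) (sym (sub-[] σ M N)) β⊃
β-sub σ (β∧ one)             = β∧ one
β-sub σ (β∧ two)             = β∧ two
β-sub σ (β∀ {M = M} {Y = Y}) = subst (β _) (sym (sub-[]ᵗ σ M Y)) β∀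

β-renᵗ : (τ : Fin n → Fin n′) → β M N → β (renᵗ τ M) (renᵗ τ N)
β-renᵗ τ (β⊃ {M = M} {N = N}) = subst (β _) (sym (renᵗ-[] τ M N)) β⊃
β-renᵗ τ (β∧ one)             = β∧ one
β-renᵗ τ (β∧ two)             = β∧ two
β-renᵗ τ (β∀ {M = M} {Y = Y}) = subst (β _) (sym (renᵗ-[]ᵗ τ M Y)) β∀

η-sub : (σ : Fin m → Termᵃ n k) → η M N → η (sub σ M) (sub σ N)
η-sub σ (η⊃ {M = M}) = subst (λ N → η (ƛ _ (N · var zero)) (sub σ M)) (sym (sub-exts-wk σ M)) η⊃
η-sub σ η∧           = η∧
η-sub σ (η∀ {M = M}) = subst (λ N → η (Λ (N ∙ zero)) (sub σ M)) (sym (sub-wkᵗ σ M)) η∀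

η-renᵗ : (τ : Fin n → Fin n′) → η M N → η (renᵗ τ M) (renᵗ τ N)
η-renᵗ τ (η⊃ {M = M}) = subst (λ N → η (ƛ _ (N · var zero)) (renᵗ τ M)) (sym (renᵗ-ren τ suc M)) η⊃
η-renᵗ τ η∧           = η∧
η-renᵗ τ (η∀ {M = M}) = subst (λ N → η (Λ (N ∙ zero)) (renᵗ τ M)) (sym (wkᵗ-renᵗ τ M)) η∀

-- Parameterised so that the same congruence and substitution lemmas serve β alone and βη. `β⊆R`
-- contracts the redexes that `＠` would have contracted; `R⊆βη` allows root steps from an
-- introduction to be inverted, leaving only its η-rule.
module Reduction
  (R : ∀ {n m} → Rel (Termᵃ n m) 0ℓ)
  (β⊆R : ∀ {n m} {M N : Termᵃ n m} → β M N → R M N)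
  (R⊆βη : ∀ {n m} {M N : Termᵃ n m} → R M N → βη M N)
  (R-sub : ∀ {n m k} {M N : Termᵃ n m} (σ : Fin m → Termᵃ n k) → R M N → R (sub σ M) (sub σ N))
  (R-renᵗ : ∀ {n n′ m} {M N : Termᵃ n m} (τ : Fin n → Fin n′) → R M N → R (renᵗ τ M) (renᵗ τ N))
  where

  infix 4 _⟶_ _⟶*_

  _⟶_ : Rel (Termᵃ n m) 0ℓ
  _⟶_ = Compatible R

  _⟶*_ : Rel (Termᵃ n m) 0ℓ
  _⟶*_ = Star _⟶_

  ≡⇒⟶* : M ≡ N → M ⟶* N
  ≡⇒⟶* refl = ε

  contract : β M N → M ⟶* N
  contract b = root (β⊆R b) ◅ ε

  ·-cong : M ⟶* M′ → N ⟶* N′ → M · N ⟶* M′ · N′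
  ·-cong r s = gmap (_· _) ·ˡ r ◅◅ gmap (_ ·_) ·ʳ s

  ⟨⟩-cong : M ⟶* M′ → N ⟶* N′ → ⟨ M , N ⟩ ⟶* ⟨ M′ , N′ ⟩
  ⟨⟩-cong r s = gmap ⟨_, _ ⟩ ⟨⟩ˡ r ◅◅ gmap ⟨ _ ,_⟩ ⟨⟩ʳ s

  ƛ-cong : M ⟶* M′ → ƛ A M ⟶* ƛ A M′
  ƛ-cong = gmap (ƛ _) ƛ

  Λ-cong : M ⟶* M′ → Λ M ⟶* Λ M′
  Λ-cong = gmap Λ Λ

  proj-cong : ∀ {i} → M ⟶* M′ → proj i M ⟶* proj i M′
  proj-cong = gmap (proj _) proj

  ∙-cong : ∀ {X} → M ⟶* M′ → M ∙ X ⟶* M′ ∙ X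
  ∙-cong = gmap (_∙ _) ∙ˡ

  ⟶-sub : (σ : Fin m → Termᵃ n k) → M ⟶ N → sub σ M ⟶ sub σ N
  ⟶-sub σ (root r) = root (R-sub σ r)
  ⟶-sub σ (ƛ r)    = ƛ (⟶-sub _ r)
  ⟶-sub σ (·ˡ r)   = ·ˡ (⟶-sub σ r)
  ⟶-sub σ (·ʳ r)   = ·ʳ (⟶-sub σ r)
  ⟶-sub σ (⟨⟩ˡ r)  = ⟨⟩ˡ (⟶-sub σ r)
  ⟶-sub σ (⟨⟩ʳ r)  = ⟨⟩ʳ (⟶-sub σ r)
  ⟶-sub σ (proj r) = proj (⟶-sub σ r)
  ⟶-sub σ (Λ r)    = Λ (⟶-sub _ r)
  ⟶-sub σ (∙ˡ r)   = ∙ˡ (⟶-sub σ r)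

  ⟶-renᵗ : (τ : Fin n → Fin n′) → M ⟶ N → renᵗ τ M ⟶ renᵗ τ N
  ⟶-renᵗ τ (root r) = root (R-renᵗ τ r)
  ⟶-renᵗ τ (ƛ r)    = ƛ (⟶-renᵗ τ r)
  ⟶-renᵗ τ (·ˡ r)   = ·ˡ (⟶-renᵗ τ r)
  ⟶-renᵗ τ (·ʳ r)   = ·ʳ (⟶-renᵗ τ r)
  ⟶-renᵗ τ (⟨⟩ˡ r)  = ⟨⟩ˡ (⟶-renᵗ τ r)
  ⟶-renᵗ τ (⟨⟩ʳ r)  = ⟨⟩ʳ (⟶-renᵗ τ r)
  ⟶-renᵗ τ (proj r) = proj (⟶-renᵗ τ r)
  ⟶-renᵗ τ (Λ r)    = Λ (⟶-renᵗ _ r)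
  ⟶-renᵗ τ (∙ˡ r)   = ∙ˡ (⟶-renᵗ τ r)

  ⟶*-sub : (σ : Fin m → Termᵃ n k) → M ⟶* N → sub σ M ⟶* sub σ N
  ⟶*-sub σ = gmap (sub σ) (⟶-sub σ)

  ⟶*-renᵗ : (τ : Fin n → Fin n′) → M ⟶* N → renᵗ τ M ⟶* renᵗ τ N
  ⟶*-renᵗ τ = gmap (renᵗ τ) (⟶-renᵗ τ)

  ⟶*-ren : (ρ : Fin m → Fin k) → M ⟶* N → ren ρ M ⟶* ren ρ N
  ⟶*-ren ρ r = subst₂ _⟶*_ (sym (ren≡sub ρ _)) (sym (ren≡sub ρ _)) (⟶*-sub _ r)

  sub-⟶* : {σ τ : Fin m → Termᵃ n k} → (∀ x → σ x ⟶* τ x) → ∀ M → sub σ M ⟶* sub τ M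
  sub-⟶* r (var x)    = r x
  sub-⟶* r (ƛ A M)    = ƛ-cong (sub-⟶* (λ { zero → ε ; (suc x) → ⟶*-ren suc (r x) }) M)
  sub-⟶* r (M · N)    = ·-cong (sub-⟶* r M) (sub-⟶* r N)
  sub-⟶* r ⟨ M , N ⟩  = ⟨⟩-cong (sub-⟶* r M) (sub-⟶* r N)
  sub-⟶* r (proj i M) = proj-cong (sub-⟶* r M)
  sub-⟶* r (Λ M)      = Λ-cong (sub-⟶* (λ x → ⟶*-renᵗ suc (r x)) M)
  sub-⟶* r (M ∙ X)    = ∙-cong (sub-⟶* r M)

  ·⇒＠ : (M N : Termᵃ n m) → M · N ⟶* M ＠ N
  ·⇒＠ (var x)    N = ε
  ·⇒＠ (ƛ A M)    N = contract β⊃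
  ·⇒＠ (M · M′)   N = ε
  ·⇒＠ ⟨ M , M′ ⟩ N = ε
  ·⇒＠ (proj i M) N = ε
  ·⇒＠ (Λ M)      N = ε
  ·⇒＠ (M ∙ X)    N = ε

  proj⇒＠proj : ∀ i (M : Termᵃ n m) → proj i M ⟶* ＠proj i M
  proj⇒＠proj i (var x)    = ε
  proj⇒＠proj i (ƛ A M)    = ε
  proj⇒＠proj i (M · N)    = ε
  proj⇒＠proj i ⟨ M , N ⟩  = contract (β∧ i)
  proj⇒＠proj i (proj j M) = ε
  proj⇒＠proj i (Λ M)      = ε
  proj⇒＠proj i (M ∙ X)    = ε

  ∙⇒＠ᵗ : (M : Termᵃ n m) (X : Fin n) → M ∙ X ⟶* M ＠ᵗ X
  ∙⇒＠ᵗ (var x)    X = ε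
  ∙⇒＠ᵗ (ƛ A M)    X = ε
  ∙⇒＠ᵗ (M · N)    X = ε
  ∙⇒＠ᵗ ⟨ M , N ⟩  X = ε
  ∙⇒＠ᵗ (proj i M) X = ε
  ∙⇒＠ᵗ (Λ M)      X = contract β∀
  ∙⇒＠ᵗ (M ∙ Y)    X = ε

  -- Contracting an η-redex M can turn M ＠ N into an application
  -- whose head has become an introduction; ·⇒＠ fires the β-redex so created.
  ＠-stepˡ : ∀ N → M ⟶ M′ → M ＠ N ⟶* M′ ＠ N
  ＠-stepˡ {M = var x}    N r     = ·ˡ r ◅ ·⇒＠ _ N
  ＠-stepˡ {M = ƛ A M}    N (ƛ r) = ⟶*-sub _ (r ◅ ε)
  ＠-stepˡ {M = ƛ A M} {M′} N (root r) with R⊆βη r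
  ... | inj₂ η⊃ = ≡⇒⟶* (cong (_· N) (wk-[] M′ N)) ◅◅ ·⇒＠ M′ N
  ＠-stepˡ {M = M · M″}   N r     = ·ˡ r ◅ ·⇒＠ _ N
  ＠-stepˡ {M = ⟨ M , M″ ⟩} N r   = ·ˡ r ◅ ·⇒＠ _ N
  ＠-stepˡ {M = proj i M} N r     = ·ˡ r ◅ ·⇒＠ _ N
  ＠-stepˡ {M = Λ M}      N r     = ·ˡ r ◅ ·⇒＠ _ N
  ＠-stepˡ {M = M ∙ X}    N r     = ·ˡ r ◅ ·⇒＠ _ N

  -- A step in the component that is not selected disappears. After a root η-step the pair is gone,
  -- and `proj⇒＠proj` handles the case that its contractum is again a pair.
  ＠proj-step : ∀ i → M ⟶ M′ → ＠proj i M ⟶* ＠proj i M′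
  ＠proj-step {M = var x}     i r       = proj r ◅ proj⇒＠proj i _
  ＠proj-step {M = ƛ A M}     i r       = proj r ◅ proj⇒＠proj i _
  ＠proj-step {M = M · M″}    i r       = proj r ◅ proj⇒＠proj i _
  ＠proj-step {M = ⟨ M , M″ ⟩} one (⟨⟩ˡ r) = r ◅ ε
  ＠proj-step {M = ⟨ M , M″ ⟩} two (⟨⟩ˡ r) = ε
  ＠proj-step {M = ⟨ M , M″ ⟩} one (⟨⟩ʳ r) = ε
  ＠proj-step {M = ⟨ M , M″ ⟩} two (⟨⟩ʳ r) = r ◅ ε
  ＠proj-step {M = ⟨ M , M″ ⟩} {M′} i (root r) with R⊆βη r
  ＠proj-step {M′ = M′} one (root r) | inj₂ η∧ = proj⇒＠proj one M′
  ＠proj-step {M′ = M′} two (root r) | inj₂ η∧ = proj⇒＠proj two M′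
  ＠proj-step {M = proj j M}  i r       = proj r ◅ proj⇒＠proj i _
  ＠proj-step {M = Λ M}       i r       = proj r ◅ proj⇒＠proj i _
  ＠proj-step {M = M ∙ X}     i r       = proj r ◅ proj⇒＠proj i _

  ＠ᵗ-step : ∀ X → M ⟶ M′ → M ＠ᵗ X ⟶* M′ ＠ᵗ X
  ＠ᵗ-step {M = var x}      X r     = ∙ˡ r ◅ ∙⇒＠ᵗ _ X
  ＠ᵗ-step {M = ƛ A M}      X r     = ∙ˡ r ◅ ∙⇒＠ᵗ _ X
  ＠ᵗ-step {M = M · M″}     X r     = ∙ˡ r ◅ ∙⇒＠ᵗ _ X
  ＠ᵗ-step {M = ⟨ M , M″ ⟩} X r     = ∙ˡ r ◅ ∙⇒＠ᵗ _ X
  ＠ᵗ-step {M = proj j M}   X r     = ∙ˡ r ◅ ∙⇒＠ᵗ _ X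
  ＠ᵗ-step {M = Λ M}        X (Λ r) = ⟶*-renᵗ _ (r ◅ ε)
  ＠ᵗ-step {M = Λ M} {M′}   X (root r) with R⊆βη r
  ... | inj₂ η∀ = ≡⇒⟶* (cong (_∙ X) (wkᵗ-[]ᵗ M′ X)) ◅◅ ∙⇒＠ᵗ M′ X
  ＠ᵗ-step {M = M ∙ Y}      X r     = ∙ˡ r ◅ ∙⇒＠ᵗ _ X

  -- Under an abstraction the argument has already been substituted, so its reduction is repeated at
  -- each occurrence.
  ＠-congʳ : ∀ M → N ⟶* N′ → M ＠ N ⟶* M ＠ N′
  ＠-congʳ (var x)    r = ·-cong ε r
  ＠-congʳ (ƛ A M)    r = sub-⟶* (λ { zero → r ; (suc x) → ε }) M
  ＠-congʳ (M · M′)   r = ·-cong ε r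
  ＠-congʳ ⟨ M , M′ ⟩ r = ·-cong ε r
  ＠-congʳ (proj i M) r = ·-cong ε r
  ＠-congʳ (Λ M)      r = ·-cong ε r
  ＠-congʳ (M ∙ X)    r = ·-cong ε r

  ＠-cong : M ⟶* M′ → N ⟶* N′ → M ＠ N ⟶* M′ ＠ N′
  ＠-cong {M = M} ε s = ＠-congʳ M s
  ＠-cong (r ◅ rs) s  = ＠-stepˡ _ r ◅◅ ＠-cong rs s

  ＠proj-cong : ∀ i → M ⟶* M′ → ＠proj i M ⟶* ＠proj i M′
  ＠proj-cong i ε        = ε
  ＠proj-cong i (r ◅ rs) = ＠proj-step i r ◅◅ ＠proj-cong i rs

  ＠ᵗ-cong : ∀ X → M ⟶* M′ → M ＠ᵗ X ⟶* M′ ＠ᵗ X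
  ＠ᵗ-cong X ε        = ε
  ＠ᵗ-cong X (r ◅ rs) = ＠ᵗ-step X r ◅◅ ＠ᵗ-cong X rs

  ƛ̲-cong : M ⟶* M′ → ƛ̲ A M ⟶* ƛ̲ A M′
  ƛ̲-cong r = ƛ-cong (·-cong (⟶*-ren suc (ƛ-cong r)) ε)

  ⟪⟫-cong : M ⟶* M′ → N ⟶* N′ → ⟪ M , N ⟫ ⟶* ⟪ M′ , N′ ⟫
  ⟪⟫-cong r s = ⟨⟩-cong (proj-cong (⟨⟩-cong r s)) (proj-cong (⟨⟩-cong r s))

  IN-cong : ∀ i → M ⟶* M′ → IN i M A B ⟶* IN i M′ A B
  IN-cong i r = Λ-cong (ƛ-cong (·-cong ε (⟶*-ren suc (⟶*-renᵗ suc r))))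

  ABORT-cong : ∀ C → M ⟶* M′ → ABORT M C ⟶* ABORT M′ C
  ABORT-cong (` X)   r = ＠ᵗ-cong X r
  ABORT-cong (C ⊃ D) r = ƛ-cong (ABORT-cong D (⟶*-ren suc r))
  ABORT-cong (C ∧ D) r = ⟨⟩-cong (ABORT-cong C r) (ABORT-cong D r)
  ABORT-cong (∀′ C)  r = Λ-cong (ABORT-cong C (⟶*-renᵗ suc r))

  CASE-cong : ∀ A B C → M ⟶* M′ → P ⟶* P′ → Q ⟶* Q′ → CASE M A P B Q C ⟶* CASE M′ A P′ B Q′ C
  CASE-cong A B (` X)   r s t = ＠-cong (＠ᵗ-cong X r) (⟨⟩-cong (ƛ-cong s) (ƛ-cong t))
  CASE-cong A B (C ⊃ D) r s t = ƛ-cong (CASE-cong A B D (⟶*-ren suc r)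
    (＠-cong (⟶*-ren (lift 1 suc) s) ε) (＠-cong (⟶*-ren (lift 1 suc) t) ε))
  CASE-cong A B (C ∧ D) r s t = ⟨⟩-cong
    (CASE-cong A B C r (＠proj-cong one s) (＠proj-cong one t))
    (CASE-cong A B D r (＠proj-cong two s) (＠proj-cong two t))
  CASE-cong A B (∀′ C)  r s t = Λ-cong (CASE-cong (wkType A) (wkType B) C (⟶*-renᵗ suc r)
    (＠ᵗ-cong zero (⟶*-renᵗ suc s)) (＠ᵗ-cong zero (⟶*-renᵗ suc t)))

  -- The one case that is more than an equality is `var x`: if `σ x` is an abstraction, the left
  -- side contains a β-redex that `＠` on the right has contracted.
  sub-＠-⟶* : (σ : Fin m → Termᵃ n k) → ∀ M N → sub σ (M ＠ N) ⟶* sub σ M ＠ sub σ N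
  sub-＠-⟶* σ (var x)    N = ·⇒＠ (σ x) _
  sub-＠-⟶* σ (ƛ A P)    N = ≡⇒⟶* (sub-[] σ P N)
  sub-＠-⟶* σ (M · M′)   N = ε
  sub-＠-⟶* σ ⟨ M , M′ ⟩ N = ε
  sub-＠-⟶* σ (proj i M) N = ε
  sub-＠-⟶* σ (Λ M)      N = ε
  sub-＠-⟶* σ (M ∙ X)    N = ε

  sub-＠proj-⟶* : (σ : Fin m → Termᵃ n k) → ∀ i M → sub σ (＠proj i M) ⟶* ＠proj i (sub σ M)
  sub-＠proj-⟶* σ i (var x)      = proj⇒＠proj i (σ x)
  sub-＠proj-⟶* σ i (ƛ A P)      = ε
  sub-＠proj-⟶* σ i (M · M′)     = ε
  sub-＠proj-⟶* σ one ⟨ M , M′ ⟩ = ε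
  sub-＠proj-⟶* σ two ⟨ M , M′ ⟩ = ε
  sub-＠proj-⟶* σ i (proj j M)   = ε
  sub-＠proj-⟶* σ i (Λ M)        = ε
  sub-＠proj-⟶* σ i (M ∙ X)      = ε

  sub-＠ᵗ-⟶* : (σ : Fin m → Termᵃ n k) → ∀ M X → sub σ (M ＠ᵗ X) ⟶* sub σ M ＠ᵗ X
  sub-＠ᵗ-⟶* σ (var x)    X = ∙⇒＠ᵗ (σ x) X
  sub-＠ᵗ-⟶* σ (ƛ A P)    X = ε
  sub-＠ᵗ-⟶* σ (M · M′)   X = ε
  sub-＠ᵗ-⟶* σ ⟨ M , M′ ⟩ X = ε
  sub-＠ᵗ-⟶* σ (proj i M) X = ε
  sub-＠ᵗ-⟶* σ (Λ M)      X = ≡⇒⟶* (sub-[]ᵗ σ M X)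
  sub-＠ᵗ-⟶* σ (M ∙ Y)    X = ε

  sub-ABORT-⟶* : (σ : Fin m → Termᵃ n k) → ∀ M C → sub σ (ABORT M C) ⟶* ABORT (sub σ M) C
  sub-ABORT-⟶* σ M (` X)   = sub-＠ᵗ-⟶* σ M X
  sub-ABORT-⟶* σ M (C ⊃ D) =
    ƛ-cong (sub-ABORT-⟶* (exts σ) (wk M) D ◅◅ ≡⇒⟶* (ABORT-≡ D (sub-exts-wk σ M)))
  sub-ABORT-⟶* σ M (C ∧ D) = ⟨⟩-cong (sub-ABORT-⟶* σ M C) (sub-ABORT-⟶* σ M D)
  sub-ABORT-⟶* σ M (∀′ C)  =
    Λ-cong (sub-ABORT-⟶* (wkᵗ ∘ σ) (wkᵗ M) C ◅◅ ≡⇒⟶* (ABORT-≡ C (sub-wkᵗ σ M)))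

  sub-CASE-⟶* : (σ : Fin m → Termᵃ n k) → ∀ M A P B Q C →
                sub σ (CASE M A P B Q C) ⟶* CASE (sub σ M) A (sub (exts σ) P) B (sub (exts σ) Q) C
  sub-CASE-⟶* σ M A P B Q (` X)   =
    sub-＠-⟶* σ (M ＠ᵗ X) _ ◅◅ ＠-cong (sub-＠ᵗ-⟶* σ M X) ε
  sub-CASE-⟶* σ M A P B Q (C ⊃ D) = ƛ-cong
    (sub-CASE-⟶* (exts σ) (wk M) A _ B _ D
     ◅◅ CASE-cong A B D (≡⇒⟶* (sub-exts-wk σ M)) (branch P) (branch Q))
    where
    branch : ∀ P → sub (exts (exts σ)) (wk₁ P ＠ var (suc zero)) ⟶*
                   wk₁ (sub (exts σ) P) ＠ var (suc zero)
    branch P = sub-＠-⟶* _ (wk₁ P) _ ◅◅ ≡⇒⟶* (cong (_＠ var (suc zero)) (sub-exts-wk₁ σ P))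
  sub-CASE-⟶* σ M A P B Q (C ∧ D) = ⟨⟩-cong
    (sub-CASE-⟶* σ M A _ B _ C ◅◅ CASE-cong A B C ε (sub-＠proj-⟶* _ one P) (sub-＠proj-⟶* _ one Q))
    (sub-CASE-⟶* σ M A _ B _ D ◅◅ CASE-cong A B D ε (sub-＠proj-⟶* _ two P) (sub-＠proj-⟶* _ two Q))
  sub-CASE-⟶* σ M A P B Q (∀′ C)  = Λ-cong
    (sub-CASE-⟶* (wkᵗ ∘ σ) (wkᵗ M) (wkType A) _ (wkType B) _ C
     ◅◅ CASE-cong (wkType A) (wkType B) C (≡⇒⟶* (sub-wkᵗ σ M)) (branch P) (branch Q))
    where
    branch : ∀ P → sub (exts (wkᵗ ∘ σ)) (wkᵗ P ＠ᵗ zero) ⟶* wkᵗ (sub (exts σ) P) ＠ᵗ zero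
    branch P = sub-＠ᵗ-⟶* _ (wkᵗ P) _ ◅◅ ≡⇒⟶* (cong (_＠ᵗ zero) (sub-exts-wkᵗ σ P))

  -- Stated for any τ that agrees pointwise with the translation of σ, so that passing under a
  -- binder asks only for the pointwise `exts-◇`.
  sub-◇ : (σ : Fin m → Term n k) {τ : Fin m → Termᵃ n k} → (∀ x → τ x ≡ σ x ◇) →
          ∀ M → sub τ (M ◇) ⟶* IPC.sub σ M ◇
  exts-◇ : (σ : Fin m → Term n k) {τ : Fin m → Termᵃ n k} → (∀ x → τ x ≡ σ x ◇) →
           ∀ x → exts τ x ≡ IPC.exts σ x ◇
  exts-◇ σ e zero    = refl
  exts-◇ σ e (suc x) = trans (cong wk (e x)) (ren-◇ suc (σ x))
  sub-◇ σ e (IPC.var x)       = ≡⇒⟶* (e x)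
  sub-◇ σ e (IPC.ƛ A M)       =
    ≡⇒⟶* (cong (λ N → ƛ (A ◇ᵗ) (N · var zero)) (sub-exts-wk _ (ƛ (A ◇ᵗ) (M ◇))))
    ◅◅ ƛ̲-cong (sub-◇ (IPC.exts σ) (exts-◇ σ e) M)
  sub-◇ σ e (M IPC.· N)       = sub-＠-⟶* _ (M ◇) (N ◇) ◅◅ ＠-cong (sub-◇ σ e M) (sub-◇ σ e N)
  sub-◇ σ e IPC.⟨ M , N ⟩     = ⟪⟫-cong (sub-◇ σ e M) (sub-◇ σ e N)
  sub-◇ σ e (IPC.proj i M)    = sub-＠proj-⟶* _ i (M ◇) ◅◅ ＠proj-cong i (sub-◇ σ e M)
  sub-◇ σ e (IPC.inj i M A B) =
    ≡⇒⟶* (cong (λ N → Λ (ƛ _ (proj i (var zero) · N)))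
               (trans (sub-exts-wk _ (wkᵗ (M ◇))) (cong wk (sub-wkᵗ _ (M ◇)))))
    ◅◅ IN-cong i (sub-◇ σ e M)
  sub-◇ σ e (IPC.case M A P B Q C) =
    sub-CASE-⟶* _ (M ◇) (A ◇ᵗ) (P ◇) (B ◇ᵗ) (Q ◇) (C ◇ᵗ)
    ◅◅ CASE-cong (A ◇ᵗ) (B ◇ᵗ) (C ◇ᵗ) (sub-◇ σ e M)
                 (sub-◇ (IPC.exts σ) (exts-◇ σ e) P) (sub-◇ (IPC.exts σ) (exts-◇ σ e) Q)
  sub-◇ σ e (IPC.abort M A)   = sub-ABORT-⟶* _ (M ◇) (A ◇ᵗ) ◅◅ ABORT-cong (A ◇ᵗ) (sub-◇ σ e M)

  []-◇ : (M : Term n (suc m)) (N : Term n m) → M ◇ [ N ◇ ] ⟶* (M IPC.[ N ]) ◇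
  []-◇ M N = sub-◇ _ (λ { zero → refl ; (suc x) → refl }) M

-- Annotations

-- The introductions at the front of M match those of the type C, annotations included;
-- on these M, ƛ C (wk M ＠ var zero) is an η-expansion of M.
data Fits {n m} : Termᵃ n m → Type n → Set where
  atom : ∀ {M X} → Fits M (` X)
  ƛ    : ∀ {P C D} → Fits P D → Fits (ƛ C P) (C ⊃ D)
  ⟨_,_⟩ : ∀ {M N C D} → Fits M C → Fits N D → Fits ⟨ M , N ⟩ (C ∧ D)
  Λ    : ∀ {P C} → Fits P C → Fits (Λ P) (∀′ C)
  var  : ∀ {x C} → Fits (var x) C
  _·_  : ∀ M N {C} → Fits (M · N) C
  proj : ∀ i M {C} → Fits (proj i M) C
  _∙_  : ∀ M X {C} → Fits (M ∙ X) C

-- A variable fits every type, while a term put in its place may not; guardedness ensures that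
-- whatever is uncovered is again a variable.
fits-sub : VarOn V W σ → Guarded V M → Fits M C → Fits (sub σ M) C
fits-sub on g          atom       = atom
fits-sub on (ƛ g)      (ƛ f)      = ƛ (fits-sub (exts-varOn false on) g f)
fits-sub on ⟨ g , h ⟩  ⟨ e , f ⟩  = ⟨ fits-sub on g e , fits-sub on h f ⟩
fits-sub on (Λ g)      (Λ f)      = Λ (fits-sub (wkᵗ-varOn on) g f)
fits-sub on (var {x} v) var with y , e , _ ← on x v = subst (λ M → Fits M _) (sym e) var
fits-sub on _          (M · N)    = _ · _
fits-sub on _          (proj i M) = proj i _
fits-sub on _          (M ∙ X)    = _ ∙ X

fits-renᵗ : (τ : Fin n → Fin n′) → Fits M C → Fits (renᵗ τ M) (renType τ C)
fits-renᵗ τ atom       = atom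
fits-renᵗ τ (ƛ f)      = ƛ (fits-renᵗ τ f)
fits-renᵗ τ ⟨ e , f ⟩  = ⟨ fits-renᵗ τ e , fits-renᵗ τ f ⟩
fits-renᵗ τ (Λ f)      = Λ (fits-renᵗ (lift 1 τ) f)
fits-renᵗ τ var        = var
fits-renᵗ τ (M · N)    = _ · _
fits-renᵗ τ (proj i M) = proj i _
fits-renᵗ τ (M ∙ X)    = _ ∙ _

fits-ren : (ρ : Fin m → Fin k) → Guarded all M → Fits M C → Fits (ren ρ M) C
fits-ren {M = M} ρ g f = subst (λ M → Fits M _) (sym (ren≡sub ρ M)) (fits-sub (var-varOn ρ) g f)

-- Serves η⊃, whose derivation types the weakened function in a longer context: fitting descends to
-- the function itself, with no strengthening of derivations.
fits-ren⁻¹ : {ρ : Fin m → Fin k} (M : Termᵃ n m) → Fits (ren ρ M) C → Fits M C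
fits-ren⁻¹ (var x)    _         = var
fits-ren⁻¹ (ƛ A P)    atom      = atom
fits-ren⁻¹ (ƛ A P)    (ƛ f)     = ƛ (fits-ren⁻¹ P f)
fits-ren⁻¹ (M · N)    _         = M · N
fits-ren⁻¹ ⟨ M , N ⟩  atom      = atom
fits-ren⁻¹ ⟨ M , N ⟩  ⟨ e , f ⟩ = ⟨ fits-ren⁻¹ M e , fits-ren⁻¹ N f ⟩
fits-ren⁻¹ (proj i M) _         = proj i M
fits-ren⁻¹ (Λ P)      atom      = atom
fits-ren⁻¹ (Λ P)      (Λ f)     = Λ (fits-ren⁻¹ P f)
fits-ren⁻¹ (M ∙ X)    _         = M ∙ X

fits-＠ : Guarded V M → Fits M (C ⊃ D) → Fits (M ＠ N) D
fits-＠ {V = V} (ƛ g) (ƛ f) = fits-sub {W = V} (λ { zero () ; (suc x) v → x , refl , v }) g f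
fits-＠ _ var        = _ · _
fits-＠ _ (M · N)    = _ · _
fits-＠ _ (proj i M) = _ · _
fits-＠ _ (M ∙ X)    = _ · _

fits-＠proj : ∀ i → Fits M (C ∧ D) → Fits (＠proj i M) (pick i C D)
fits-＠proj one ⟨ e , f ⟩  = e
fits-＠proj two ⟨ e , f ⟩  = f
fits-＠proj i   var        = proj i _
fits-＠proj i   (M · N)    = proj i _
fits-＠proj i   (proj j M) = proj i _
fits-＠proj i   (M ∙ X)    = proj i _

fits-＠ᵗ : ∀ X → Fits M (∀′ C) → Fits (M ＠ᵗ X) (renType (X ∷ᶠ id) C)
fits-＠ᵗ X (Λ f)      = fits-renᵗ _ f
fits-＠ᵗ X var        = _ ∙ _
fits-＠ᵗ X (M · N)    = _ ∙ _
fits-＠ᵗ X (proj j M) = _ ∙ _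
fits-＠ᵗ X (M ∙ Y)    = _ ∙ _

fits-wkᵗ-＠ᵗ : Fits M (∀′ C) → Fits (wkᵗ M ＠ᵗ zero) C
fits-wkᵗ-＠ᵗ {C = C} f = subst (Fits _)
  (trans (renType-∘ _ _ C) (trans (renType-cong (λ { zero → refl ; (suc X) → refl }) C) (renType-id C)))
  (fits-＠ᵗ zero (fits-renᵗ suc f))

-- `CASE` produces its outer introductions by recursion on `C` and takes their annotations from `C`,
-- independently of the branches.
fits-CASE : ∀ (M : Termᵃ n m) A P B Q C → Fits (CASE M A P B Q C) C
fits-CASE M A P B Q (` X)   = atom
fits-CASE M A P B Q (C ⊃ D) = ƛ (fits-CASE _ A _ B _ D)
fits-CASE M A P B Q (C ∧ D) = ⟨ fits-CASE M A _ B _ C , fits-CASE M A _ B _ D ⟩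
fits-CASE M A P B Q (∀′ C)  = Λ (fits-CASE _ _ _ _ _ C)

fits-ABORT : ∀ (M : Termᵃ n m) C → Fits (ABORT M C) C
fits-ABORT M (` X)   = atom
fits-ABORT M (C ⊃ D) = ƛ (fits-ABORT _ D)
fits-ABORT M (C ∧ D) = ⟨ fits-ABORT M C , fits-ABORT M D ⟩
fits-ABORT M (∀′ C)  = Λ (fits-ABORT _ C)

pick-map : ∀ {a b} {X : Set a} {Y : Set b} (f : X → Y) i {x y} → pick i (f x) (f y) ≡ f (pick i x y)
pick-map f one = refl
pick-map f two = refl

-- The typing rules of `case` and `abort` make the ascribed type the type of the term, and it is
-- from the ascribed type that the translation builds its introductions.
fits-◇ : {Γ : Vec (Form n) m} {M : Term n m} {A : Form n} → Γ ⊢ M ∶ A → Fits (M ◇) (A ◇ᵗ)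
fits-◇ (IPC.var _)    = var
fits-◇ (IPC.ƛ d)      = ƛ (_ · _)
fits-◇ (IPC._·_ {M = M} d e) = fits-＠ (guarded-◇ M) (fits-◇ d)
fits-◇ IPC.⟨ d , e ⟩  = ⟨ proj _ _ , proj _ _ ⟩
fits-◇ (IPC.proj i d) = subst (Fits _) (pick-map _◇ᵗ i) (fits-＠proj i (fits-◇ d))
fits-◇ (IPC.inj i d)  = Λ (ƛ (_ · _))
fits-◇ (IPC.case d e f) = fits-CASE _ _ _ _ _ _
fits-◇ (IPC.abort d)  = fits-ABORT _ _

-- Instances for β and βη; η-contractions and case analysis of injections

module Rβ = Reduction β id inj₁ β-sub β-renᵗ

module Rβη = Reduction βη inj₁ id (λ σ → [ inj₁ ∘ β-sub σ , inj₂ ∘ η-sub σ ])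
                                 (λ τ → [ inj₁ ∘ β-renᵗ τ , inj₂ ∘ η-renᵗ τ ])

open Rβη

contract-η : η M N → M ⟶* N
contract-η r = root (inj₂ r) ◅ ε

wk₁-[var] : (P : Termᵃ n (suc m)) → wk₁ P [ var zero ] ≡ P
wk₁-[var] P = trans (sub-ren _ _ P) (trans (sub-cong e P) (sub-var P))
  where
  e : (var zero ∷ᶠ var) ∘ lift 1 suc ≗ var
  e zero    = refl
  e (suc x) = refl

ƛ-η : Fits M (C ⊃ D) → ƛ C (wk M ＠ var zero) ⟶* M
ƛ-η (ƛ {P = P} f) = ≡⇒⟶* (cong (ƛ _) (wk₁-[var] P))
ƛ-η var           = contract-η η⊃
ƛ-η (M · N)       = contract-η η⊃
ƛ-η (proj i M)    = contract-η η⊃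
ƛ-η (M ∙ X)       = contract-η η⊃

-- A pair carries no annotation, so the expansion of a pair is that pair on the nose, for every `M`
-- of this shape; any other `M` takes one η-step.
⟨⟩-η : (M : Termᵃ n m) → ⟨ ＠proj one M , ＠proj two M ⟩ ⟶* M
⟨⟩-η (var x)    = contract-η η∧
⟨⟩-η (ƛ A M)    = contract-η η∧
⟨⟩-η (M · N)    = contract-η η∧
⟨⟩-η ⟨ M , N ⟩  = ε
⟨⟩-η (proj i M) = contract-η η∧
⟨⟩-η (Λ M)      = contract-η η∧
⟨⟩-η (M ∙ X)    = contract-η η∧

Λ-η : (M : Termᵃ n m) → Λ (wkᵗ M ＠ᵗ zero) ⟶* M
Λ-η (var x)    = contract-η η∀
Λ-η (ƛ A M)    = contract-η η∀
Λ-η (M · N)    = contract-η η∀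
Λ-η ⟨ M , N ⟩  = contract-η η∀
Λ-η (proj i M) = contract-η η∀
Λ-η (Λ M)      = ≡⇒⟶* (cong Λ (wkᵗ-Λ-＠ᵗ M))
Λ-η (M ∙ X)    = contract-η η∀

-- The two terms before substitution differ by swapping the two innermost variables.
branch-[] : {P : Termᵃ n (suc m)} → Guarded all P → ∀ M →
            (wk₁ P ＠ var (suc zero)) [ wk M ] ≡ sub (exts (M ∷ᶠ var)) (wk P ＠ var zero)
branch-[] {n} {m} {P} g M = begin
  (wk₁ P ＠ var (suc zero)) [ wk M ]           ≡⟨ cong (_[ wk M ]) (sym swapped) ⟩
  sub swap (wk P ＠ var zero) [ wk M ]         ≡⟨ sub-∘ _ swap (wk P ＠ var zero) ⟩
  sub (sub (wk M ∷ᶠ var) ∘ swap) (wk P ＠ var zero)  ≡⟨ sub-cong e (wk P ＠ var zero) ⟩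
  sub (exts (M ∷ᶠ var)) (wk P ＠ var zero)     ∎
  where
  open ≡-Reasoning
  swapᶠ : Fin (suc (suc m)) → Fin (suc (suc m))
  swapᶠ = suc zero ∷ᶠ zero ∷ᶠ (λ x → suc (suc x))
  swap : Fin (suc (suc m)) → Termᵃ n (suc (suc m))
  swap = var ∘ swapᶠ
  e : sub (wk M ∷ᶠ var) ∘ swap ≗ exts (M ∷ᶠ var)
  e zero          = refl
  e (suc zero)    = refl
  e (suc (suc x)) = refl
  e′ : swap ∘ suc ≗ var ∘ lift 1 suc
  e′ zero    = refl
  e′ (suc x) = refl
  swapped : sub swap (wk P ＠ var zero) ≡ wk₁ P ＠ var (suc zero)
  swapped = trans (sub-＠ (var-varOn swapᶠ) (guarded-ren-all g) (var zero))
    (cong (_＠ var (suc zero)) (trans (sub-ren swap suc P) (trans (sub-cong e′ P) (sym (ren≡sub _ P)))))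

wk-IN : ∀ i (M : Termᵃ n m) A B → wk (IN i M A B) ≡ IN i (wk M) A B
wk-IN i M A B = cong (λ N → Λ (ƛ _ (proj i (var zero) · N)))
  (trans (wk-ren suc (wkᵗ M)) (cong wk (sym (renᵗ-ren suc suc M))))

wkᵗ-IN : ∀ i (M : Termᵃ n m) A B → wkᵗ (IN i M A B) ≡ IN i (wkᵗ M) (wkType A) (wkType B)
wkᵗ-IN i M A B = cong Λ (cong₂ ƛ
  (cong₂ (λ A B → (A ⊃ ` zero) ∧ (B ⊃ ` zero)) (wkType-renType suc A) (wkType-renType suc B))
  (cong (proj i (var zero) ·_) (trans (renᵗ-ren _ suc (wkᵗ M)) (cong wk (wkᵗ-renᵗ suc M)))))

IN-＠ : ∀ i (M : Termᵃ n m) A B X N → (IN i M A B ＠ᵗ X) ＠ N ≡ proj i N · M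
IN-＠ i M A B X N = cong (proj i N ·_)
  (trans (cong (_[ N ]) (trans (renᵗ-ren _ suc (wkᵗ M)) (cong wk (wkᵗ-[]ᵗ M X)))) (wk-[] M N))

-- Induction on `C`. At a compound type the induction hypothesis for the stripped branches gives an
-- η-expansion of the chosen branch with `M` substituted. The expansion is contracted on the branch
-- itself and the step then substituted, because `M` is arbitrary here and the branch with `M` in it
-- need not fit `C`.
CASE-IN : ∀ i (M : Termᵃ n m) A P B Q C → Guarded all (pick i P Q) → Fits (pick i P Q) C →
          CASE (IN i M A B) A P B Q C ⟶* pick i P Q [ M ]
CASE-IN i M A P B Q (` X) g f =
  ≡⇒⟶* (IN-＠ i M A B X _) ◅◅ ·-cong (contract (β∧ i)) ε ◅◅ contract-pick i
  where
  contract-pick : ∀ i → pick i (ƛ A P) (ƛ B Q) · M ⟶* pick i P Q [ M ]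
  contract-pick one = contract β⊃
  contract-pick two = contract β⊃
CASE-IN {n} {m} i M A P B Q (C ⊃ D) g f =
  ƛ-cong (≡⇒⟶* (CASE-≡ A B D (wk-IN i M A B) refl refl)
          ◅◅ CASE-IN i (wk M) A _ B _ D (subst (Guarded all) (sym e) (guarded-＠ (guarded-ren-all g)))
                     (subst (λ P → Fits P D) (sym e) (fits-＠ (guarded-ren-all g) (fits-ren (lift 1 suc) g f)))
          ◅◅ ≡⇒⟶* (trans (cong (_[ wk M ]) e) (branch-[] g M)))
  ◅◅ ⟶*-sub (M ∷ᶠ var) (ƛ-η f)
  where
  e : pick i (wk₁ P ＠ var (suc zero)) (wk₁ Q ＠ var (suc zero)) ≡ wk₁ (pick i P Q) ＠ var (suc zero)
  e = pick-map (λ P → wk₁ P ＠ var (suc zero)) i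
CASE-IN i M A P B Q (C ∧ D) g f =
  ⟨⟩-cong (component one C (fits-＠proj one f)) (component two D (fits-＠proj two f))
  ◅◅ ⟶*-sub (M ∷ᶠ var) (⟨⟩-η (pick i P Q))
  where
  component : ∀ j E → Fits (＠proj j (pick i P Q)) E →
              CASE (IN i M A B) A (＠proj j P) B (＠proj j Q) E ⟶* ＠proj j (pick i P Q) [ M ]
  component j E h = CASE-IN i M A _ B _ E (subst (Guarded all) (sym e) (guarded-＠proj j g))
                            (subst (λ P → Fits P E) (sym e) h)
                    ◅◅ ≡⇒⟶* (cong (_[ M ]) e)
    where
    e : pick i (＠proj j P) (＠proj j Q) ≡ ＠proj j (pick i P Q)
    e = pick-map (＠proj j) i
CASE-IN i M A P B Q (∀′ C) g f =
  Λ-cong (≡⇒⟶* (CASE-≡ (wkType A) (wkType B) C (wkᵗ-IN i M A B) refl refl)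
          ◅◅ CASE-IN i (wkᵗ M) (wkType A) _ (wkType B) _ C
                     (subst (Guarded all) (sym e) (guarded-＠ᵗ (guarded-renᵗ g)))
                     (subst (λ P → Fits P C) (sym e) (fits-wkᵗ-＠ᵗ f))
          ◅◅ ≡⇒⟶* (trans (cong (_[ wkᵗ M ]) e) (sub-cong e′ (wkᵗ (pick i P Q) ＠ᵗ zero))))
  ◅◅ ⟶*-sub (M ∷ᶠ var) (Λ-η (pick i P Q))
  where
  e : pick i (wkᵗ P ＠ᵗ zero) (wkᵗ Q ＠ᵗ zero) ≡ wkᵗ (pick i P Q) ＠ᵗ zero
  e = pick-map (λ P → wkᵗ P ＠ᵗ zero) i
  e′ : (wkᵗ M ∷ᶠ var) ≗ wkᵗ ∘ (M ∷ᶠ var)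
  e′ zero    = refl
  e′ (suc x) = refl

-- Let w be the variable bound by the `⊃` clause. Each injection, instantiated and applied to w,
-- computes to `proj i w · x`. So η⊃ turns the branches into the two projections of w, η∧ turns
-- their pair into w, and `ƛ-η` and `Λ-η` remove the outer introductions.
CASE-IN-η : ∀ {M : Termᵃ n m} {A B} → Guarded all M → Fits M (A ∨ B) →
            CASE M A (IN one (var zero) A B) B (IN two (var zero) A B) (A ∨ B) ⟶* M
CASE-IN-η {n} {m} {M} {A} {B} g f =
  Λ-cong (ƛ-cong (＠-cong (≡⇒⟶* (sym (ren-＠ᵗ suc (guarded-renᵗ g) zero)))
                          (⟨⟩-cong (branch one) (branch two) ◅◅ contract-η η∧))
          ◅◅ ƛ-η (fits-wkᵗ-＠ᵗ f))
  ◅◅ Λ-η M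
  where
  branch : ∀ {A′} i →
           ƛ {m = suc m} A′ (wk₁ (wkᵗ (IN i (var zero) A B) ＠ᵗ zero) ＠ var (suc zero)) ⟶* proj i (var zero)
  branch i = contract-η η⊃

-- Root steps of each rule under the translation

private variable
  R : Rule
  Γ : Vec (Form n) m
  F : Form n

-- The expansion in `ƛ̲` absorbs the `＠`: the redex translates to the genuine redex
-- `ƛ (A ◇ᵗ) (M ◇) · N ◇`.
β⊃-◇ : {M N : Term n m} → M ▷[ β⊃ ] N → M ◇ ⟶β* N ◇
β⊃-◇ (β⊃ {A = A} {M = M} {N = N}) =
  Rβ.≡⇒⟶* (cong (_· N ◇) (wk-[] (ƛ (A ◇ᵗ) (M ◇)) (N ◇))) ◅◅ Rβ.contract β⊃ ◅◅ Rβ.[]-◇ M N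

β∧-◇ : {M N : Term n m} → M ▷[ β∧ ] N → M ◇ ⟶β* N ◇
β∧-◇ (β∧ one) = Rβ.contract (β∧ one)
β∧-◇ (β∧ two) = Rβ.contract (β∧ two)

β∨-◇ : {M N : Term n m} → Γ ⊢ M ∶ F → M ▷[ β∨ ] N → M ◇ ⟶βη* N ◇
β∨-◇ (IPC.case _ p _) (β∨ {M = M} {A} {B} {P} {Q} {C} one) =
  CASE-IN one (M ◇) (A ◇ᵗ) (P ◇) (B ◇ᵗ) (Q ◇) (C ◇ᵗ) (guarded-◇ P) (fits-◇ p) ◅◅ []-◇ P M
β∨-◇ (IPC.case _ _ q) (β∨ {M = M} {A} {B} {P} {Q} {C} two) =
  CASE-IN two (M ◇) (A ◇ᵗ) (P ◇) (B ◇ᵗ) (Q ◇) (C ◇ᵗ) (guarded-◇ Q) (fits-◇ q) ◅◅ []-◇ Q M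

-- The pattern `IPC.var refl` identifies the annotation of the abstraction with the domain in the
-- type of `M`. The first η-step removes the expansion that comes from `ƛ̲`, the second that of the
-- redex.
η⊃-◇ : {M N : Term n m} → Γ ⊢ M ∶ F → M ▷[ η⊃ ] N → M ◇ ⟶βη* N ◇
η⊃-◇ (IPC.ƛ (d IPC.· IPC.var refl)) (η⊃ {A} {M}) rewrite sym (ren-◇ suc M) =
  contract-η η⊃ ◅◅ ƛ-η (fits-ren⁻¹ (M ◇) (subst (λ N → Fits N _) (sym (ren-◇ suc M)) (fits-◇ d)))

η∧-◇ : {M N : Term n m} → M ▷[ η∧ ] N → M ◇ ⟶βη* N ◇
η∧-◇ (η∧ {M = M}) = contract-η η∧ ◅◅ ⟨⟩-η (M ◇)

η∨-◇ : {M N : Term n m} → Γ ⊢ M ∶ F → M ▷[ η∨ ] N → M ◇ ⟶βη* N ◇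
η∨-◇ (IPC.case d _ _) (η∨ {M = M}) = CASE-IN-η (guarded-◇ M) (fits-◇ d)

π⊃-◇ : {M N : Term n m} → M ▷[ π⊃ ] N → M ◇ ≡ N ◇
π⊃-◇ (π⊃ {M} {A} {P} {B} {Q} {C} {D} {N}) =
  trans (CASE-＠ (guarded-◇ M) (guarded-◇ P) (guarded-◇ Q) (A ◇ᵗ) (B ◇ᵗ) (C ◇ᵗ) (D ◇ᵗ) (N ◇))
        (CASE-≡ (A ◇ᵗ) (B ◇ᵗ) (D ◇ᵗ) refl
                (cong (P ◇ ＠_) (ren-◇ suc N)) (cong (Q ◇ ＠_) (ren-◇ suc N)))

-- `CASE` at a conjunction is by definition a pair of `CASE`s over projected branches, and `＠proj`
-- selects one of them.
π∧-◇ : {M N : Term n m} → M ▷[ π∧ ] N → M ◇ ≡ N ◇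
π∧-◇ (π∧ one) = refl
π∧-◇ (π∧ two) = refl

π∨-◇ : {M N : Term n m} → M ▷[ π∨ ] N → M ◇ ≡ N ◇
π∨-◇ (π∨ {M} {A} {P′} {B} {Q′} {C} {P} {D} {Q} {E}) =
  trans (CASE-CASE (guarded-◇ M) (guarded-◇ P′) (guarded-◇ Q′) (guarded-◇ P) (guarded-◇ Q)
                   (A ◇ᵗ) (B ◇ᵗ) (C ◇ᵗ) (D ◇ᵗ) (E ◇ᵗ))
        (CASE-≡ (A ◇ᵗ) (B ◇ᵗ) (E ◇ᵗ) refl (branch P′) (branch Q′))
  where
  branch = λ P′ → CASE-≡ {M = P′ ◇} (C ◇ᵗ) (D ◇ᵗ) (E ◇ᵗ) refl
                         (ren-◇ (lift 1 suc) P) (ren-◇ (lift 1 suc) Q)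

π⊥-◇ : {M N : Term n m} → M ▷[ π⊥ ] N → M ◇ ≡ N ◇
π⊥-◇ (π⊥ {M} {A} {P} {B} {Q} {C}) =
  ABORT-CASE (guarded-◇ M) (guarded-◇ P) (guarded-◇ Q) (A ◇ᵗ) (B ◇ᵗ) (C ◇ᵗ)

ϖ⊃-◇ : {M N : Term n m} → M ▷[ ϖ⊃ ] N → M ◇ ≡ N ◇
ϖ⊃-◇ (ϖ⊃ {M} {C} {D} {N}) = ABORT-＠ (guarded-◇ M) (C ◇ᵗ) (D ◇ᵗ) (N ◇)

ϖ∧-◇ : {M N : Term n m} → M ▷[ ϖ∧ ] N → M ◇ ≡ N ◇
ϖ∧-◇ (ϖ∧ one) = refl
ϖ∧-◇ (ϖ∧ two) = refl

ϖ∨-◇ : {M N : Term n m} → M ▷[ ϖ∨ ] N → M ◇ ≡ N ◇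
ϖ∨-◇ (ϖ∨ {M} {C} {P} {D} {Q} {E}) = CASE-ABORT (guarded-◇ M) (P ◇) (Q ◇) (C ◇ᵗ) (D ◇ᵗ) (E ◇ᵗ)

ϖ⊥-◇ : {M N : Term n m} → M ▷[ ϖ⊥ ] N → M ◇ ≡ N ◇
ϖ⊥-◇ (ϖ⊥ {M} {C}) = ABORT-ABORT (guarded-◇ M) (C ◇ᵗ)

-- Compatible closure and the theorem

⟶-◇-≡ : (∀ {n m} {M N : Term n m} → M ▷[ R ] N → M ◇ ≡ N ◇) →
        {M N : Term n m} → M ⟶[ R ] N → M ◇ ≡ N ◇
⟶-◇-≡ h (IPC.root r)  = h r
⟶-◇-≡ h (IPC.ƛ r)     = cong (ƛ̲ _) (⟶-◇-≡ h r)
⟶-◇-≡ h (IPC.·ˡ r)    = cong (_＠ _) (⟶-◇-≡ h r)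
⟶-◇-≡ h (IPC.·ʳ {M = M} r) = cong (M ◇ ＠_) (⟶-◇-≡ h r)
⟶-◇-≡ h (IPC.⟨⟩ˡ r)   = cong ⟪_, _ ⟫ (⟶-◇-≡ h r)
⟶-◇-≡ h (IPC.⟨⟩ʳ r)   = cong ⟪ _ ,_⟫ (⟶-◇-≡ h r)
⟶-◇-≡ h (IPC.proj r)  = cong (＠proj _) (⟶-◇-≡ h r)
⟶-◇-≡ h (IPC.inj {i = i} r) = cong (λ M → IN i M _ _) (⟶-◇-≡ h r)
⟶-◇-≡ h (IPC.case₁ {C = C} r) = CASE-≡ _ _ (C ◇ᵗ) (⟶-◇-≡ h r) refl refl
⟶-◇-≡ h (IPC.case₂ {C = C} r) = CASE-≡ _ _ (C ◇ᵗ) refl (⟶-◇-≡ h r) refl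
⟶-◇-≡ h (IPC.case₃ {C = C} r) = CASE-≡ _ _ (C ◇ᵗ) refl refl (⟶-◇-≡ h r)
⟶-◇-≡ h (IPC.abort {A = A} r) = ABORT-≡ (A ◇ᵗ) (⟶-◇-≡ h r)

⟶-◇-β : (∀ {n m} {M N : Term n m} → M ▷[ R ] N → M ◇ ⟶β* N ◇) →
        {M N : Term n m} → M ⟶[ R ] N → M ◇ ⟶β* N ◇
⟶-◇-β h (IPC.root r)  = h r
⟶-◇-β h (IPC.ƛ r)     = Rβ.ƛ̲-cong (⟶-◇-β h r)
⟶-◇-β h (IPC.·ˡ r)    = Rβ.＠-cong (⟶-◇-β h r) ε
⟶-◇-β h (IPC.·ʳ {M = M} r) = Rβ.＠-cong {M = M ◇} ε (⟶-◇-β h r)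
⟶-◇-β h (IPC.⟨⟩ˡ r)   = Rβ.⟪⟫-cong (⟶-◇-β h r) ε
⟶-◇-β h (IPC.⟨⟩ʳ r)   = Rβ.⟪⟫-cong ε (⟶-◇-β h r)
⟶-◇-β h (IPC.proj r)  = Rβ.＠proj-cong _ (⟶-◇-β h r)
⟶-◇-β h (IPC.inj r)   = Rβ.IN-cong _ (⟶-◇-β h r)
⟶-◇-β h (IPC.case₁ {C = C} r) = Rβ.CASE-cong _ _ (C ◇ᵗ) (⟶-◇-β h r) ε ε
⟶-◇-β h (IPC.case₂ {C = C} r) = Rβ.CASE-cong _ _ (C ◇ᵗ) ε (⟶-◇-β h r) ε
⟶-◇-β h (IPC.case₃ {C = C} r) = Rβ.CASE-cong _ _ (C ◇ᵗ) ε ε (⟶-◇-β h r)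
⟶-◇-β h (IPC.abort {A = A} r) = Rβ.ABORT-cong (A ◇ᵗ) (⟶-◇-β h r)

-- The derivation is followed along the path to the redex, so that the root case receives a typing
-- of the redex in its own, possibly longer, context.
⟶-◇-βη : (∀ {n m} {Γ : Vec (Form n) m} {F} {M N : Term n m} →
          Γ ⊢ M ∶ F → M ▷[ R ] N → M ◇ ⟶βη* N ◇) →
         {M N : Term n m} → Γ ⊢ M ∶ F → M ⟶[ R ] N → M ◇ ⟶βη* N ◇
⟶-◇-βη h d              (IPC.root r)  = h d r
⟶-◇-βη h (IPC.ƛ d)      (IPC.ƛ r)     = ƛ̲-cong (⟶-◇-βη h d r)
⟶-◇-βη h (d IPC.· _)    (IPC.·ˡ r)    = ＠-cong (⟶-◇-βη h d r) ε
⟶-◇-βη h (_ IPC.· d)    (IPC.·ʳ {M = M} r) = ＠-cong {M = M ◇} ε (⟶-◇-βη h d r)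
⟶-◇-βη h IPC.⟨ d , _ ⟩  (IPC.⟨⟩ˡ r)   = ⟪⟫-cong (⟶-◇-βη h d r) ε
⟶-◇-βη h IPC.⟨ _ , d ⟩  (IPC.⟨⟩ʳ r)   = ⟪⟫-cong ε (⟶-◇-βη h d r)
⟶-◇-βη h (IPC.proj i d) (IPC.proj r)  = ＠proj-cong i (⟶-◇-βη h d r)
⟶-◇-βη h (IPC.inj i d)  (IPC.inj r)   = IN-cong i (⟶-◇-βη h d r)
⟶-◇-βη h (IPC.case d _ _) (IPC.case₁ {C = C} r) = CASE-cong _ _ (C ◇ᵗ) (⟶-◇-βη h d r) ε ε
⟶-◇-βη h (IPC.case _ d _) (IPC.case₂ {C = C} r) = CASE-cong _ _ (C ◇ᵗ) ε (⟶-◇-βη h d r) ε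
⟶-◇-βη h (IPC.case _ _ d) (IPC.case₃ {C = C} r) = CASE-cong _ _ (C ◇ᵗ) ε ε (⟶-◇-βη h d r)
⟶-◇-βη h (IPC.abort d)  (IPC.abort {A = A} r) = ABORT-cong (A ◇ᵗ) (⟶-◇-βη h d r)

theorem1 : ∀ {n m} (R : Rule) (M N : Term n m) →
    (R ∈ β⊃ ∷ β∧ ∷ [] → M ⟶[ R ] N → M ◇ ⟶β* N ◇)
    × (R ∈ β∨ ∷ η∨ ∷ η⊃ ∷ η∧ ∷ [] →
    ∀ (Γ : Vec (Form n) m) (A : Form n) → Γ ⊢ M ∶ A → M ⟶[ R ] N → M ◇ ⟶βη* N ◇)
    × (R ∈ π⊃ ∷ π∧ ∷ π∨ ∷ π⊥ ∷ ϖ⊃ ∷ ϖ∧ ∷ ϖ∨ ∷ ϖ⊥ ∷ [] → M ⟶[ R ] N → M ◇ ≡ N ◇)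
theorem1 R M N = part₁ , (λ R∈ Γ A → part₂ R∈) , part₃
  where
  part₁ : R ∈ β⊃ ∷ β∧ ∷ [] → M ⟶[ R ] N → M ◇ ⟶β* N ◇
  part₁ (here refl)         = ⟶-◇-β β⊃-◇
  part₁ (there (here refl)) = ⟶-◇-β β∧-◇
  part₂ : R ∈ β∨ ∷ η∨ ∷ η⊃ ∷ η∧ ∷ [] → Γ ⊢ M ∶ F → M ⟶[ R ] N → M ◇ ⟶βη* N ◇
  part₂ (here refl)                         = ⟶-◇-βη β∨-◇
  part₂ (there (here refl))                 = ⟶-◇-βη η∨-◇
  part₂ (there (there (here refl)))         = ⟶-◇-βη η⊃-◇
  part₂ (there (there (there (here refl)))) = ⟶-◇-βη (λ _ → η∧-◇)
  part₃ : R ∈ π⊃ ∷ π∧ ∷ π∨ ∷ π⊥ ∷ ϖ⊃ ∷ ϖ∧ ∷ ϖ∨ ∷ ϖ⊥ ∷ [] → M ⟶[ R ] N → M ◇ ≡ N ◇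
  part₃ (here refl)                                                         = ⟶-◇-≡ π⊃-◇
  part₃ (there (here refl))                                                 = ⟶-◇-≡ π∧-◇
  part₃ (there (there (here refl)))                                         = ⟶-◇-≡ π∨-◇
  part₃ (there (there (there (here refl))))                                 = ⟶-◇-≡ π⊥-◇
  part₃ (there (there (there (there (here refl)))))                         = ⟶-◇-≡ ϖ⊃-◇
  part₃ (there (there (there (there (there (here refl))))))                 = ⟶-◇-≡ ϖ∧-◇
  part₃ (there (there (there (there (there (there (here refl)))))))         = ⟶-◇-≡ ϖ∨-◇
  part₃ (there (there (there (there (there (there (there (here refl)))))))) = ⟶-◇-≡ ϖ⊥-◇
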